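{- For every $\varepsilon>0$ there exist $n_0$ and $\delta>0$ such that if $G$ is an $n$-vertex oriented graph with $n\ge n_0$ and $$t(G)+i(G)\le \tfrac19+\delta,$$ then $G$ is $\varepsilon$-close to $\mathcal B_n$.
   Context: An oriented graph is a directed graph with no loops and no multiple (parallel or anti-parallel) edges. For an oriented graph $G$, $t(G)$ (resp. $i(G)$) is the probability that a uniformly random $3$-set of vertices induces a transitive triangle (resp. an independent set). For a positive integer $n$, $\mathcal B_n=(V,E)$ is the balanced blowup of a cyclic triangle: $V$ is the disjoint union of $V_0,V_1,V_2$ with $|V_i|=\lfloor (n+i)/3\rfloor$, and $E$ consists of all directed edges from $V_i$ to $V_{i+1 \bmod 3}$ for $0\le i\le 2$. Two $n$-vertex graphs $G$ and $H$ are $\varepsilon$-close if there are sets $E_1,E_2\subseteq\binom{V(G)}{2}$ with $|E_1|+|E_2|\le\varepsilon n^2$ such that $(G\setminus E_1)\cup E_2$ is isomorphic to $H$. -}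

module Defs where

open import Data.Bool using (Bool; true; false; _∧_; _∨_; not; if_then_else_)
open import Data.Nat using (ℕ; zero; suc; _+_; _*_; _<ᵇ_; _≡ᵇ_)
open import Data.Nat.DivMod using (_/_)
open import Data.Nat.Combinatorics using (_C_)
open import Data.Fin using (Fin; toℕ)
open import Data.List using (List; map; allFin)
open import Data.Nat.ListAction using (sum)
open import Data.Integer using (+_)
open import Data.Rational as ℚ using (ℚ; 0ℚ)
open import Function.Bundles using (_↔_; Inverse)
open import Relation.Binary.PropositionalEquality using (_≡_)

record OrientedGraph (n : ℕ) : Set where
  field
    adj      : Fin n → Fin n → Bool
    loopless : ∀ u → adj u u ≡ false
    oriented : ∀ u v → adj u v ≡ true → adj v u ≡ false
open OrientedGraph public

𝟙 : Bool → ℕ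
𝟙 true  = 1
𝟙 false = 0

countPairs : ∀ {n} → (Fin n → Fin n → Bool) → ℕ
countPairs {n} P =
  sum (map (λ u → sum (map (λ v → 𝟙 ((toℕ u <ᵇ toℕ v) ∧ P u v)) (allFin n))) (allFin n))

countTriples : ∀ {n} → (Fin n → Fin n → Fin n → Bool) → ℕ
countTriples {n} P =
  sum (map (λ a → sum (map (λ b → sum (map (λ c →
    𝟙 ((toℕ a <ᵇ toℕ b) ∧ (toℕ b <ᵇ toℕ c) ∧ P a b c))
    (allFin n))) (allFin n))) (allFin n))

adjacent : ∀ {n} → OrientedGraph n → Fin n → Fin n → Bool
adjacent G u v = adj G u v ∨ adj G v u

cyclic : ∀ {n} → OrientedGraph n → Fin n → Fin n → Fin n → Bool
cyclic G a b c =
  (adj G a b ∧ adj G b c ∧ adj G c a) ∨ (adj G a c ∧ adj G c b ∧ adj G b a)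

transitiveTriple : ∀ {n} → OrientedGraph n → Fin n → Fin n → Fin n → Bool
transitiveTriple G a b c =
  adjacent G a b ∧ adjacent G b c ∧ adjacent G a c ∧ not (cyclic G a b c)

independentTriple : ∀ {n} → OrientedGraph n → Fin n → Fin n → Fin n → Bool
independentTriple G a b c =
  not (adjacent G a b) ∧ not (adjacent G b c) ∧ not (adjacent G a c)

-- k / N as a rational; convention 0 when N = 0 (i.e. n < 3; irrelevant for large n)
ratio : ℕ → ℕ → ℚ
ratio k zero    = 0ℚ
ratio k (suc m) = (+ k) ℚ./ (suc m)

t : ∀ {n} → OrientedGraph n → ℚ
t {n} G = ratio (countTriples (transitiveTriple G)) (n C 3)

i : ∀ {n} → OrientedGraph n → ℚ
i {n} G = ratio (countTriples (independentTriple G)) (n C 3)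

-- Balanced blowup B_n of the cyclic triangle on Fin n:
-- V_0 = first ⌊n/3⌋ vertices, V_1 = next ⌊(n+1)/3⌋, V_2 = remaining ⌊(n+2)/3⌋.
part : ∀ {n} → Fin n → ℕ
part {n} v =
  if toℕ v <ᵇ (n / 3) then 0
  else if toℕ v <ᵇ (n / 3 + (n + 1) / 3) then 1
  else 2

next3 : ℕ → ℕ
next3 0 = 1
next3 1 = 2
next3 _ = 0

Badj : ∀ {n} → Fin n → Fin n → Bool
Badj u v = part v ≡ᵇ next3 (part u)

-- ε-closeness of the edited graph to B_n.
-- E1 : pairs to delete (the pair {u,v} is deleted iff R u v ∨ R v u);
-- E2 : pairs to add, each with a chosen orientation (the pair {u,v} is added
--      with orientation u → v iff A u v).
-- |E1| + |E2| ≤ ε n², and (G ∖ E1) ∪ E2 ≅ B_n via a bijection σ of the vertices.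
edited : ∀ {n} → OrientedGraph n → (Fin n → Fin n → Bool) → (Fin n → Fin n → Bool)
       → Fin n → Fin n → Bool
edited G R A u v = (adj G u v ∧ not (R u v ∨ R v u)) ∨ A u v

CloseToB : (ε : ℚ) → ∀ {n} → OrientedGraph n → Set
CloseToB ε {n} G =
  Σ (Fin n → Fin n → Bool) λ R → Σ (Fin n → Fin n → Bool) λ A →
    (((+ (countPairs (λ u v → R u v ∨ R v u) + countPairs (λ u v → A u v ∨ A v u))) ℚ./ 1)
       ℚ.≤ ε ℚ.* ((+ (n * n)) ℚ./ 1))
    × Σ (Fin n ↔ Fin n) λ σ →
        ∀ u v → edited G R A u v ≡ Badj (Inverse.to σ u) (Inverse.to σ v)
  where open import Data.Product using (Σ; _×_)

oneNinth : ℚ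
oneNinth = (+ 1) ℚ./ 9

module Submission where

-- Call ordered triples of vertices, repetitions allowed, transitive or independent in the obvious way; this amounts to
-- counting in the blow-ups of G, and changes the densities by O(1/n) only. A sum-of-squares certificate on four
-- vertices (found as a semidefinite program over flags rooted at pairs of vertices) shows
--   45 · #{transitive or independent (a, b, c)} ≥ 5 n³ + 2 ∑ᵤ S(u),
--   S(u) = #{transitive (u, x, y)} + (3 d⁺(u) − n)² + (3 d⁻(u) − n)².
-- So if t + i is close to 1/9, then S is small on average. Pick u with S(u) small and let V₀, V₁, V₂ be its
-- non-neighbours, out-neighbours and in-neighbours. They have about n/3 vertices each; as u lies in few transitive
-- triples, V₁ and V₂ span few edges and few edges go from V₂ to V₁. Since almost all in- and out-degrees are about n/3,
-- counting the edges at V₁, then at V₂ and at V₀ forces almost every pair to follow the pattern V₀ → V₁ → V₂ → V₀.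
-- Moving a few vertices between the parts makes their sizes those of B_n.
--
-- Degrees are indispensable here: deleting few edges from B_n changes t + i to second order only, so no bound on the
-- number of triples with one edge can be linear in t + i − 1/9.

module Stability where

  open import Defs hiding (i; t)
  open import Data.Bool using (Bool; true; false; _∧_; _∨_; not; _xor_; if_then_else_)
  import Data.Bool.Properties as Bool
  open import Data.Fin using (Fin; zero; suc; #_; toℕ; fromℕ<; punchIn)
  open import Data.Fin.Permutation using (Permutation′; _⟨$⟩ʳ_; insert; insert-punchIn) renaming (id to idₚ)
  open import Data.Fin.Properties using (toℕ-fromℕ<; any?; all?)
  open import Data.Integer using (ℤ; +_; +[1+_]; -[1+_]; _+_; _*_; _-_; -_; _≤_; _<_; _≤?_; 0ℤ; Positive; positive; +≤+; +<+)
    renaming (suc to sucℤ)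
  open import Data.Integer.Properties
  open import Data.Integer.Tactic.RingSolver using (solve-∀)
  open import Data.List using (List; []; _∷_; allFin; map; tabulate)
  open import Data.List.Properties using (map-tabulate)
  open import Data.Nat as ℕ using (ℕ; z≤n; s≤s; _<ᵇ_; ∣_-_∣)
  open import Data.Nat.Combinatorics using (_C_; nC1≡n; nCk+nC[k+1]≡[n+1]C[k+1])
  open import Data.Nat.DivMod using (_/_; _%_; m≡m%n+[m/n]*n; m%n<n)
  open import Data.Nat.ListAction using () renaming (sum to sumᴸ)
  import Data.Nat.Properties as ℕ
  import Data.Nat.Tactic.RingSolver as ℕ
  open import Data.Product using (Σ; _×_; _,_; proj₁; proj₂)
  open import Data.Rational as ℚ using (ℚ; mkℚ; 0ℚ)
  import Data.Rational.Properties as ℚ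
  open import Data.Rational.Unnormalised as ℚᵘ using (mkℚᵘ; *≤*)
  import Data.Rational.Unnormalised.Properties as ℚᵘ
  open import Data.Vec using (lookup; []; _∷_)
  open import Relation.Binary.PropositionalEquality
  open import Relation.Nullary using (Dec; yes; no; contradiction)
  open import Relation.Nullary.Decidable using (from-yes; map′; _×-dec_)
  open import Algebra.Properties.Semiring.Sum +-*-semiring renaming (sum to ∑)
    using (sum-cong-≗; ∑-distrib-+; ∑-comm; sum-permute; *-distribˡ-sum; *-distribʳ-sum)

  -- Relations between vertices and the sum-of-squares certificate on four vertices.

  -- How u is related to v: u → v, v → u, or neither. A vertex is unrelated to itself.
  data Rel : Set where
    fwd bwd non : Rel

  inv : Rel → Rel
  inv fwd = bwd
  inv bwd = fwd
  inv non = non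

  ∀Rel? : ∀ {p} {P : Rel → Set p} → (∀ r → Dec (P r)) → Dec (∀ r → P r)
  ∀Rel? P? = map′ (λ { (pf , pb , pn) → λ { fwd → pf ; bwd → pb ; non → pn } })
                  (λ f → f fwd , f bwd , f non)
                  (P? fwd ×-dec P? bwd ×-dec P? non)

  -- Scaled so that ∑ₓ e⁺ (r u x) = 3 d⁺(u) − n and ∑ₓ e⁻ (r u x) = 3 d⁻(u) − n.
  e⁺ e⁻ : Rel → ℤ
  e⁺ fwd = + 2
  e⁺ bwd = - + 1
  e⁺ non = - + 1
  e⁻ r = e⁺ (inv r)

  -- On a triple (a, b, c) the arguments are the relations of a to b, of b to c and of a to c.
  trans³ indep³ : Rel → Rel → Rel → ℤ
  trans³ non _   _   = + 0
  trans³ _   non _   = + 0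
  trans³ _   _   non = + 0
  trans³ fwd fwd bwd = + 0
  trans³ bwd bwd fwd = + 0
  trans³ _   _   _   = + 1
  indep³ non non non = + 1
  indep³ _   _   _   = + 0

  ti : Rel → Rel → Rel → ℤ
  ti r s q = trans³ r s q + indep³ r s q

  table : (ff fb fn bf bb bn nf nb nn : ℤ) → Rel → Rel → ℤ
  table ff fb fn bf bb bn nf nb nn fwd fwd = ff
  table ff fb fn bf bb bn nf nb nn fwd bwd = fb
  table ff fb fn bf bb bn nf nb nn fwd non = fn
  table ff fb fn bf bb bn nf nb nn bwd fwd = bf
  table ff fb fn bf bb bn nf nb nn bwd bwd = bb
  table ff fb fn bf bb bn nf nb nn bwd non = bn
  table ff fb fn bf bb bn nf nb nn non fwd = nf
  table ff fb fn bf bb bn nf nb nn non bwd = nb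
  table ff fb fn bf bb bn nf nb nn non non = nn

  -- For a pair (a, b) related by the argument: positive weights and forms in the relations of a and b to a third vertex
  -- c. These are the squares of the certificate, rounded from a numerical solution. Each form vanishes on average over c
  -- when G is B_n, and those at an unrelated pair also vanish when the pair is a deleted edge of B_n.
  squares : Rel → List (ℕ × (Rel → Rel → ℤ))
  squares non =
      (504  , table (+ 1) (+ 0) (+ 0)
                    (+ 0) (+ 1) (+ 0)
                    (+ 0) (+ 0) (- + 2))
    ∷ (770  , table (+ 0) (+ 0) (+ 1)
                    (+ 0) (+ 0) (- + 1)
                    (+ 1) (- + 1) (+ 0))
    ∷ (1120 , table (+ 0) (+ 0) (+ 1)
                    (+ 0) (+ 0) (+ 1)
                    (- + 1) (- + 1) (+ 0))
    ∷ []
  squares fwd =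
      (3    , table (+ 10) (+ 0) (- + 14)
                    (+ 28) (+ 10) (+ 16)
                    (+ 16) (- + 14) (- + 17))
    ∷ (70   , table (- + 6) (+ 0) (+ 0)
                    (+ 0) (- + 6) (- + 4)
                    (- + 4) (+ 0) (+ 5))
    ∷ (700  , table (+ 2) (+ 0) (+ 0)
                    (+ 0) (+ 2) (- + 1)
                    (- + 1) (+ 0) (+ 0))
    ∷ (28   , table (+ 0) (+ 0) (- + 9)
                    (+ 0) (+ 0) (- + 1)
                    (+ 1) (+ 9) (+ 0))
    ∷ (3300 , table (+ 0) (+ 0) (+ 0)
                    (+ 0) (+ 0) (+ 1)
                    (- + 1) (+ 0) (+ 0))
    ∷ []
  squares bwd = []

  quad : List (ℕ × (Rel → Rel → ℤ)) → (a b c d : Rel) → ℤ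
  quad []            a b c d = + 0
  quad ((k , f) ∷ L) a b c d = + k * (f a b * f c d) + quad L a b c d

  -- `sym₄` chooses the vertex in last place, `sym₃` the one in third place and `sym₂` the order of
  -- the other two, so `symmetrise` meets each of the 24 orderings once.
  sym₂ sym₃ sym₄ : ∀ {V : Set} → (V → V → V → V → ℤ) → V → V → V → V → ℤ
  sym₂ F a b c d = F a b c d + F b a c d
  sym₃ F a b c d = F a b c d + F a c b d + F b c a d
  sym₄ F a b c d = F a b c d + F a b d c + F a c d b + F b c d a

  symmetrise : ∀ {V : Set} → (V → V → V → V → ℤ) → V → V → V → V → ℤ
  symmetrise F = sym₄ (sym₃ (sym₂ F))

  -- The normalisation 2520 = 9 · 280 makes the averages of upper and lower agree on B_n.
  opaque
    upper lower : (ab ac ad bc bd : Rel) → ℤ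
    upper ab ac ad bc bd = + 2520 * ti ab bc ac
    lower ab ac ad bc bd =
        + 280
      + + 112 * trans³ ab bc ac
      + + 112 * (e⁺ ac * e⁺ ad + e⁻ ac * e⁻ ad)
      + quad (squares ab) ac bc ad bd

  on5 : ∀ {V : Set} → (Rel → Rel → Rel → Rel → Rel → ℤ) → (V → V → Rel) → V → V → V → V → ℤ
  on5 Φ r a b c d = Φ (r a b) (r a c) (r a d) (r b c) (r b d)

  -- The two directions of a pair are separate arguments, so that the entries can first be
  -- instantiated with `r u w` and `r w u` and then be identified through `r-inv`.
  matrix : (ab ac ad bc bd cd ba ca da cb db dc : Rel) → Fin 4 → Fin 4 → Rel
  matrix ab ac ad bc bd cd ba ca da cb db dc i j = lookup (lookup
    ( (non ∷ ab  ∷ ac  ∷ ad  ∷ [])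
    ∷ (ba  ∷ non ∷ bc  ∷ bd  ∷ [])
    ∷ (ca  ∷ cb  ∷ non ∷ cd  ∷ [])
    ∷ (da  ∷ db  ∷ dc  ∷ non ∷ [])
    ∷ []) i) j

  on4 : (Fin 4 → Fin 4 → Fin 4 → Fin 4 → ℤ) → ℤ
  on4 F = F (# 0) (# 1) (# 2) (# 3)

  opaque
    unfolding upper lower

    -- Sums over all quadruples see only the symmetrisation, so the 24 orderings may be compared
    -- together. Six relations leave 3⁶ = 729 cases, decided by evaluation; they include quadruples
    -- with repetitions, as a vertex is unrelated to itself.
    lower≤upper : ∀ ab ac ad bc bd cd →
      let r = matrix ab ac ad bc bd cd (inv ab) (inv ac) (inv ad) (inv bc) (inv bd) (inv cd) in
      on4 (symmetrise (on5 lower r)) ≤ on4 (symmetrise (on5 upper r))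
    lower≤upper = from-yes (∀Rel? λ ab → ∀Rel? λ ac → ∀Rel? λ ad → ∀Rel? λ bc → ∀Rel? λ bd → ∀Rel? λ cd →
      let r = matrix ab ac ad bc bd cd (inv ab) (inv ac) (inv ad) (inv bc) (inv bd) (inv cd) in
      on4 (symmetrise (on5 lower r)) ≤? on4 (symmetrise (on5 upper r)))

  -- Finite sums and nonnegativity of the squares.

  ∑-mono : ∀ {n} {f g : Fin n → ℤ} → (∀ i → f i ≤ g i) → ∑ f ≤ ∑ g
  ∑-mono {ℕ.zero}  f≤g = ≤-refl
  ∑-mono {ℕ.suc n} f≤g = +-mono-≤ (f≤g zero) (∑-mono λ i → f≤g (suc i))

  ∑-const : ∀ n c → ∑ {n} (λ _ → c) ≡ + n * c
  ∑-const ℕ.zero    c = refl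
  ∑-const (ℕ.suc n) c = begin
    c + ∑ {n} (λ _ → c) ≡⟨ cong (λ s → c + s) (∑-const n c) ⟩
    c + + n * c         ≡⟨ suc-* (+ n) c ⟨
    + ℕ.suc n * c       ∎
    where open ≡-Reasoning

  ∑-*ˡ : ∀ {n} c (f : Fin n → ℤ) → ∑ (λ i → c * f i) ≡ c * ∑ f
  ∑-*ˡ c f = sym (*-distribˡ-sum c f)

  ∑∑-*ˡ : ∀ {m n} c (f : Fin m → Fin n → ℤ) → ∑ (λ x → ∑ λ y → c * f x y) ≡ c * ∑ (λ x → ∑ (f x))
  ∑∑-*ˡ c f = trans (sum-cong-≗ λ x → ∑-*ˡ c (f x)) (∑-*ˡ c (λ x → ∑ (f x)))

  ∑∑-* : ∀ {m n} (f : Fin m → ℤ) (g : Fin n → ℤ) → ∑ (λ x → ∑ λ y → f x * g y) ≡ ∑ f * ∑ g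
  ∑∑-* f g = trans (sum-cong-≗ λ x → ∑-*ˡ (f x) g) (sym (*-distribʳ-sum (∑ g) f))

  ∑∑-+ : ∀ {m n} (f g : Fin m → Fin n → ℤ) →
         ∑ (λ x → ∑ λ y → f x y + g x y) ≡ ∑ (λ x → ∑ (f x)) + ∑ (λ x → ∑ (g x))
  ∑∑-+ f g = trans (sum-cong-≗ λ x → ∑-distrib-+ (f x) (g x)) (∑-distrib-+ (λ x → ∑ (f x)) (λ x → ∑ (g x)))

  0≤i*i : ∀ i → 0ℤ ≤ i * i
  0≤i*i (+ n)    = subst (0ℤ ≤_) (pos-* n n) (+≤+ z≤n)
  0≤i*i -[1+ n ] = +≤+ z≤n

  0≤*ˡ : ∀ k {i} → 0ℤ ≤ i → 0ℤ ≤ + k * i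
  0≤*ˡ k {i} 0≤i = begin
    0ℤ        ≡⟨ *-zeroʳ (+ k) ⟨
    + k * 0ℤ  ≤⟨ *-monoˡ-≤-nonNeg (+ k) 0≤i ⟩
    + k * i   ∎
    where open ≤-Reasoning

  -- For fixed roots, the product of a form at x and the same form at y sums to the square of the
  -- sum of the form over one vertex.
  ∑∑quad≥0 : ∀ {n} L (p q : Fin n → Rel) → 0ℤ ≤ ∑ (λ x → ∑ λ y → quad L (p x) (q x) (p y) (q y))
  ∑∑quad≥0 {n} [] p q = ≤-reflexive (sym (trans (sum-cong-≗ {n} λ _ → ∑-zero n) (∑-zero n)))
    where
    ∑-zero : ∀ n → ∑ {n} (λ _ → 0ℤ) ≡ 0ℤ
    ∑-zero n = trans (∑-const n 0ℤ) (*-zeroʳ (+ n))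
  ∑∑quad≥0 ((k , f) ∷ L) p q = subst (0ℤ ≤_)
    (sym (∑∑-+ (λ x y → + k * (f (p x) (q x) * f (p y) (q y))) (λ x y → quad L (p x) (q x) (p y) (q y))))
    (+-mono-≤ 0≤k*sq (∑∑quad≥0 L p q))
    where
    g = λ x → f (p x) (q x)
    eq : ∑ (λ x → ∑ λ y → + k * (g x * g y)) ≡ + k * (∑ g * ∑ g)
    eq = trans (sum-cong-≗ λ x → ∑-*ˡ (+ k) (λ y → g x * g y))
        (trans (∑-*ˡ (+ k) (λ x → ∑ λ y → g x * g y)) (cong (λ s → + k * s) (∑∑-* g g)))
    0≤k*sq : 0ℤ ≤ ∑ (λ x → ∑ λ y → + k * (g x * g y))
    0≤k*sq = subst (0ℤ ≤_) (sym eq) (0≤*ˡ k (0≤i*i (∑ g)))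

  -- Sums over quadruples and their invariance under reordering.

  module _ {n : ℕ} where

    ∑₄ : (Fin n → Fin n → Fin n → Fin n → ℤ) → ℤ
    ∑₄ F = ∑ λ a → ∑ λ b → ∑ λ c → ∑ λ d → F a b c d

    ∑₄-mono : ∀ {F G} → (∀ a b c d → F a b c d ≤ G a b c d) → ∑₄ F ≤ ∑₄ G
    ∑₄-mono le = ∑-mono λ a → ∑-mono λ b → ∑-mono λ c → ∑-mono λ d → le a b c d

    ∑₄-+ : ∀ F G → ∑₄ (λ a b c d → F a b c d + G a b c d) ≡ ∑₄ F + ∑₄ G
    ∑₄-+ F G = trans (sum-cong-≗ λ a → sum-cong-≗ λ b → ∑∑-+ (F a b) (G a b))
      (∑∑-+ (λ a b → ∑ λ c → ∑ λ d → F a b c d) (λ a b → ∑ λ c → ∑ λ d → G a b c d))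

    ∑₄-swap₁ : ∀ F → ∑₄ (λ a b c d → F b a c d) ≡ ∑₄ F
    ∑₄-swap₁ F = ∑-comm (λ a b → ∑ λ c → ∑ λ d → F b a c d)

    ∑₄-swap₂ : ∀ F → ∑₄ (λ a b c d → F a c b d) ≡ ∑₄ F
    ∑₄-swap₂ F = sum-cong-≗ λ a → ∑-comm (λ b c → ∑ λ d → F a c b d)

    ∑₄-swap₃ : ∀ F → ∑₄ (λ a b c d → F a b d c) ≡ ∑₄ F
    ∑₄-swap₃ F = sum-cong-≗ λ a → sum-cong-≗ λ b → ∑-comm (λ c d → F a b d c)

    ∑₄-sym₂ : ∀ F → ∑₄ (sym₂ F) ≡ + 2 * ∑₄ F
    ∑₄-sym₂ F = trans (∑₄-+ F _) (trans (cong (λ s → ∑₄ F + s) (∑₄-swap₁ F)) (lemma (∑₄ F)))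
      where
      lemma : ∀ s → s + s ≡ + 2 * s
      lemma = solve-∀

    ∑₄-sym₃ : ∀ F → ∑₄ (sym₃ F) ≡ + 3 * ∑₄ F
    ∑₄-sym₃ F = trans (∑₄-+ (λ a b c d → F a b c d + F a c b d) F₂)
      (trans (cong₂ _+_ (trans (∑₄-+ F F₁) (cong (λ s → ∑₄ F + s) eq₁)) eq₂) (lemma (∑₄ F)))
      where
      F₁ F₂ : Fin n → Fin n → Fin n → Fin n → ℤ
      F₁ a b c d = F a c b d
      F₂ a b c d = F b c a d
      eq₁ = ∑₄-swap₂ F
      eq₂ = trans (∑₄-swap₁ F₁) eq₁
      lemma : ∀ s → s + s + s ≡ + 3 * s
      lemma = solve-∀

    ∑₄-sym₄ : ∀ F → ∑₄ (sym₄ F) ≡ + 4 * ∑₄ F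
    ∑₄-sym₄ F = trans (∑₄-+ (λ a b c d → F a b c d + F₁ a b c d + F₂ a b c d) F₃)
      (trans (cong₂ _+_ (trans (∑₄-+ (λ a b c d → F a b c d + F₁ a b c d) F₂)
        (cong₂ _+_ (trans (∑₄-+ F F₁) (cong (λ s → ∑₄ F + s) eq₁)) eq₂)) eq₃) (lemma (∑₄ F)))
      where
      F₁ F₂ F₃ : Fin n → Fin n → Fin n → Fin n → ℤ
      F₁ a b c d = F a b d c
      F₂ a b c d = F a c d b
      F₃ a b c d = F b c d a
      eq₁ = ∑₄-swap₃ F
      eq₂ = trans (∑₄-swap₂ F₁) eq₁
      eq₃ = trans (∑₄-swap₁ F₂) eq₂
      lemma : ∀ s → s + s + s + s ≡ + 4 * s
      lemma = solve-∀

    ∑₄-sym : ∀ F → ∑₄ (symmetrise F) ≡ + 24 * ∑₄ F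
    ∑₄-sym F = trans (∑₄-sym₄ (sym₃ (sym₂ F)))
      (trans (cong (λ s → + 4 * s) (trans (∑₄-sym₃ (sym₂ F)) (cong (λ s → + 3 * s) (∑₄-sym₂ F)))) (lemma (∑₄ F)))
      where
      lemma : ∀ s → + 4 * (+ 3 * (+ 2 * s)) ≡ + 24 * s
      lemma = solve-∀

  -- The certificate summed over all quadruples.

  module Density {n : ℕ} (r : Fin n → Fin n → Rel) (r-inv : ∀ u v → r v u ≡ inv (r u v)) where

    pointwise : ∀ u w x y → symmetrise (on5 lower r) u w x y ≤ symmetrise (on5 upper r) u w x y
    pointwise u w x y = transport (r u w) (r u x) (r u y) (r w x) (r w y) (r x y)
        (r w u) (r x u) (r y u) (r x w) (r y w) (r y x)
        (r-inv u w) (r-inv u x) (r-inv u y) (r-inv w x) (r-inv w y) (r-inv x y)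
      where
      transport : ∀ ab ac ad bc bd cd ba ca da cb db dc →
        ba ≡ inv ab → ca ≡ inv ac → da ≡ inv ad → cb ≡ inv bc → db ≡ inv bd → dc ≡ inv cd →
        (let r = matrix ab ac ad bc bd cd ba ca da cb db dc) →
        on4 (symmetrise (on5 lower r)) ≤ on4 (symmetrise (on5 upper r))
      transport ab ac ad bc bd cd _ _ _ _ _ _ refl refl refl refl refl refl = lower≤upper ab ac ad bc bd cd

    E⁺ E⁻ T S : Fin n → ℤ
    E⁺ u = ∑ λ x → e⁺ (r u x)
    E⁻ u = ∑ λ x → e⁻ (r u x)
    T  u = ∑ λ x → ∑ λ y → trans³ (r u x) (r x y) (r u y)
    S  u = T u + E⁺ u * E⁺ u + E⁻ u * E⁻ u

    TI : ℤ
    TI = ∑ λ u → ∑ λ x → ∑ λ y → ti (r u x) (r x y) (r u y)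

    private N = + n

    opaque
      unfolding upper lower

      ∑₄-upper : ∑₄ (on5 upper r) ≡ + 2520 * (N * TI)
      ∑₄-upper = begin
        ∑₄ (on5 upper r)
          ≡⟨ (sum-cong-≗ λ u → sum-cong-≗ λ w → sum-cong-≗ λ x → ∑-const n (+ 2520 * j u w x)) ⟩
        (∑ λ u → ∑ λ w → ∑ λ x → N * (+ 2520 * j u w x))
          ≡⟨ (sum-cong-≗ λ u → trans
               (sum-cong-≗ λ w → trans (∑-*ˡ N (λ x → + 2520 * j u w x)) (cong (λ s → N * s) (∑-*ˡ (+ 2520) (j u w))))
               (trans (∑-*ˡ N (λ w → + 2520 * ∑ (j u w))) (cong (λ s → N * s) (∑-*ˡ (+ 2520) (λ w → ∑ (j u w)))))) ⟩
        (∑ λ u → N * (+ 2520 * ∑ λ w → ∑ (j u w)))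
          ≡⟨ ∑-*ˡ N (λ u → + 2520 * ∑ λ w → ∑ (j u w)) ⟩
        N * (∑ λ u → + 2520 * ∑ λ w → ∑ (j u w))
          ≡⟨ cong (λ s → N * s) (∑-*ˡ (+ 2520) (λ u → ∑ λ w → ∑ (j u w))) ⟩
        N * (+ 2520 * TI) ≡⟨ lemma N TI ⟩
        + 2520 * (N * TI) ∎
        where
        open ≡-Reasoning
        j : Fin n → Fin n → Fin n → ℤ
        j u w x = ti (r u w) (r w x) (r u x)
        lemma : ∀ a b → a * (+ 2520 * b) ≡ + 2520 * (a * b)
        lemma = solve-∀

      -- The squares are dropped. Of the remaining terms, the transitive one ignores y and the
      -- degree one ignores w, so each sums to N times its share of `S`.
      ∑₄-lower : N * (+ 280 * (N * (N * N)) + + 112 * ∑ S) ≤ ∑₄ (on5 lower r)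
      ∑₄-lower = begin
        N * (+ 280 * (N * (N * N)) + + 112 * ∑ S)
          ≡⟨ cong (λ s → N * (s + + 112 * ∑ S)) (trans (lemma₀ N) (sym (∑-const n (+ 280 * (N * N))))) ⟩
        N * (∑ {n} (λ _ → + 280 * (N * N)) + + 112 * ∑ S)
          ≡⟨ cong (λ s → N * (∑ {n} (λ _ → + 280 * (N * N)) + s)) (sym (∑-*ˡ (+ 112) S)) ⟩
        N * (∑ {n} (λ _ → + 280 * (N * N)) + ∑ (λ u → + 112 * S u))
          ≡⟨ cong (λ s → N * s) (sym (∑-distrib-+ {n} (λ _ → + 280 * (N * N)) (λ u → + 112 * S u))) ⟩
        N * ∑ (λ u → + 280 * (N * N) + + 112 * S u)
          ≡⟨ sym (∑-*ˡ N (λ u → + 280 * (N * N) + + 112 * S u)) ⟩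
        ∑ (λ u → N * (+ 280 * (N * N) + + 112 * S u))
          ≡⟨ sum-cong-≗ (λ u → sym (per-u u)) ⟩
        (∑ λ u → ∑ λ w → N * (+ 280 * N + + 112 * t u w) + + 112 * D u)
          ≡⟨ (sum-cong-≗ λ u → sum-cong-≗ λ w → sym (per-uw u w)) ⟩
        (∑ λ u → ∑ λ w → ∑ λ x → ∑ λ y → rest u w x y)
          ≤⟨ (∑-mono λ u → ∑-mono λ w → add-quad u w) ⟩
        ∑₄ (on5 lower r) ∎
        where
        open ≤-Reasoning
        D : Fin n → ℤ
        D u = E⁺ u * E⁺ u + E⁻ u * E⁻ u
        t : Fin n → Fin n → ℤ
        t u w = ∑ λ x → trans³ (r u w) (r w x) (r u x)
        dd : Fin n → Fin n → Fin n → ℤ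
        dd u x y = e⁺ (r u x) * e⁺ (r u y) + e⁻ (r u x) * e⁻ (r u y)
        tt : Fin n → Fin n → Fin n → ℤ
        tt u w x = + 280 + + 112 * trans³ (r u w) (r w x) (r u x)
        rest : Fin n → Fin n → Fin n → Fin n → ℤ
        rest u w x y = tt u w x + + 112 * dd u x y
        lemma₀ : ∀ a → + 280 * (a * (a * a)) ≡ a * (+ 280 * (a * a))
        lemma₀ = solve-∀
        per-uw : ∀ u w → ∑ (λ x → ∑ λ y → rest u w x y) ≡ N * (+ 280 * N + + 112 * t u w) + + 112 * D u
        per-uw u w = trans (∑∑-+ {n} {n} (λ x _ → tt u w x) (λ x y → + 112 * dd u x y)) (cong₂ _+_
          (trans (sum-cong-≗ λ x → ∑-const n (tt u w x)) (trans (∑-*ˡ N (tt u w)) (cong (λ s → N * s)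
            (trans (∑-distrib-+ {n} (λ _ → + 280) (λ x → + 112 * trans³ (r u w) (r w x) (r u x)))
              (cong₂ _+_ (trans (∑-const n (+ 280)) (*-comm N (+ 280))) (∑-*ˡ (+ 112) (λ x → trans³ (r u w) (r w x) (r u x))))))))
          (trans (sum-cong-≗ λ x → ∑-*ˡ (+ 112) (dd u x)) (trans (∑-*ˡ (+ 112) (λ x → ∑ (dd u x))) (cong (λ s → + 112 * s)
            (trans (∑∑-+ (λ x y → e⁺ (r u x) * e⁺ (r u y)) (λ x y → e⁻ (r u x) * e⁻ (r u y)))
              (cong₂ _+_ (∑∑-* (λ x → e⁺ (r u x)) (λ y → e⁺ (r u y))) (∑∑-* (λ x → e⁻ (r u x)) (λ y → e⁻ (r u y)))))))))
        lemma₂ : ∀ a t x y → a * (+ 280 * (a * a)) + a * (+ 112 * t) + a * (+ 112 * (x + y)) ≡ a * (+ 280 * (a * a) + + 112 * (t + x + y))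
        lemma₂ = solve-∀
        lemma₃ : ∀ a → a * (a * (+ 280 * a)) ≡ a * (+ 280 * (a * a))
        lemma₃ = solve-∀
        lemma₄ : ∀ a b c → a * (b + c) ≡ a * b + a * c
        lemma₄ = solve-∀
        per-u : ∀ u → ∑ (λ w → N * (+ 280 * N + + 112 * t u w) + + 112 * D u) ≡ N * (+ 280 * (N * N) + + 112 * S u)
        per-u u = trans (∑-distrib-+ (λ w → N * (+ 280 * N + + 112 * t u w)) (λ _ → + 112 * D u)) (trans (cong₂ _+_
          (trans (∑-*ˡ N (λ w → + 280 * N + + 112 * t u w)) (trans (cong (λ s → N * s)
            (trans (∑-distrib-+ {n} (λ _ → + 280 * N) (λ w → + 112 * t u w)) (cong₂ _+_ (∑-const n (+ 280 * N)) (∑-*ˡ (+ 112) (t u)))))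
            (trans (lemma₄ N (N * (+ 280 * N)) (+ 112 * ∑ (t u))) (cong (λ s → s + N * (+ 112 * ∑ (t u))) (lemma₃ N)))))
          (∑-const n (+ 112 * D u))) (lemma₂ N (∑ (t u)) (E⁺ u * E⁺ u) (E⁻ u * E⁻ u)))
        add-quad : ∀ u w → ∑ (λ x → ∑ λ y → rest u w x y) ≤ ∑ (λ x → ∑ λ y → on5 lower r u w x y)
        add-quad u w = begin
          ∑ (λ x → ∑ λ y → rest u w x y) ≡⟨ sym (+-identityʳ (∑ λ x → ∑ λ y → rest u w x y)) ⟩
          ∑ (λ x → ∑ λ y → rest u w x y) + 0ℤ ≤⟨ +-monoʳ-≤ (∑ λ x → ∑ λ y → rest u w x y) (∑∑quad≥0 (squares (r u w)) (r u) (r w)) ⟩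
          ∑ (λ x → ∑ λ y → rest u w x y) + ∑ (λ x → ∑ λ y → quad (squares (r u w)) (r u x) (r w x) (r u y) (r w y))
            ≡⟨ sym (∑∑-+ (rest u w) (λ x y → quad (squares (r u w)) (r u x) (r w x) (r u y) (r w y))) ⟩
          ∑ (λ x → ∑ λ y → on5 lower r u w x y) ∎

    TI-bound : N * (+ 5 * (N * (N * N)) + + 2 * ∑ S) ≤ + 45 * (N * TI)
    -- The factor 24 of the orderings cancels, and so does the common factor 56 of 280, 112 and
    -- 2520.
    TI-bound = *-cancelˡ-≤-pos _ _ (+ 56) (subst₂ _≤_ (lemma N (∑ S)) (*-assoc (+ 56) (+ 45) (N * TI))
      (≤-trans ∑₄-lower (subst (λ s → ∑₄ (on5 lower r) ≤ s) ∑₄-upper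
        (*-cancelˡ-≤-pos _ _ (+ 24) (subst₂ _≤_ (∑₄-sym (on5 lower r)) (∑₄-sym (on5 upper r)) (∑₄-mono pointwise))))))
      where
      lemma : ∀ N s → N * (+ 280 * (N * (N * N)) + + 112 * s) ≡ + 56 * (N * (+ 5 * (N * (N * N)) + + 2 * s))
      lemma = solve-∀

  -- Pairs that violate the cyclic pattern of the parts.

  -- From here on a relation also names a part: a vertex x lies in V₀, V₁ or V₂ according to whether its relation r u x
  -- from the chosen vertex u is non, fwd or bwd.
  isFwd : Rel → Bool
  isFwd fwd = true
  isFwd _   = false

  succ? : Rel → Rel → Bool
  succ? non fwd = true
  succ? fwd bwd = true
  succ? bwd non = true
  succ? _   _   = false

  𝟙ℤ : Bool → ℤ
  𝟙ℤ b = + 𝟙 b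

  -- Only the edge from the first vertex to the second is compared with the pattern; the opposite
  -- direction is left to the swapped pair.
  wrong : Rel → Rel → Rel → ℤ
  wrong c d r = 𝟙ℤ (isFwd r xor succ? c d)

  -- For (c, d, r) = (r u x, r u y, r x y) the sum of cost over x, y is 9 W plus terms of the sizes of the parts that vanish
  -- when all sizes are n/3. The weights express the order in which degrees are used: in-degrees on V₁ (weight 4, they give
  -- the edges V₀ → V₁, which three other counts rely on), out-degrees on V₁ and V₂, and on V₀ with the opposite sign.
  wt⁺ wt⁻ : Rel → ℤ
  wt⁺ fwd = - + 1
  wt⁺ bwd = - + 2
  wt⁺ non = + 1
  wt⁻ fwd = - + 4
  wt⁻ _   = + 0

  opaque
    cost budget : Rel → Rel → Rel → ℤ
    cost c d r = + 9 * wrong c d r + (+ 7 * e⁺ c + + 5 * e⁻ c)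
      + (+ 3 * (e⁺ c * e⁺ d) + + 4 * (e⁺ c * e⁻ d) + + 2 * (e⁻ c * e⁻ d))
    budget c d r = + 36 * trans³ c r d + + 3 * (wt⁺ c * e⁺ r + wt⁻ c * e⁻ r)

    -- A check of 27 cases. Both orders of a pair are taken together, as both sides get summed over
    -- all ordered pairs; the summed budget consists of the transitive triples at u and of degree
    -- deviations weighted by part.
    cost≤budget : ∀ c d r → cost c d r + cost d c (inv r) ≤ budget c d r + budget d c (inv r)
    cost≤budget = from-yes (∀Rel? λ c → ∀Rel? λ d → ∀Rel? λ r →
      cost c d r + cost d c (inv r) ≤? budget c d r + budget d c (inv r))

  wt⁺²≤4 : ∀ r → wt⁺ r * wt⁺ r ≤ + 4
  wt⁺²≤4 = from-yes (∀Rel? λ r → wt⁺ r * wt⁺ r ≤? + 4)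

  wt⁻²≤16 : ∀ r → wt⁻ r * wt⁻ r ≤ + 16
  wt⁻²≤16 = from-yes (∀Rel? λ r → wt⁻ r * wt⁻ r ≤? + 16)

  0≤trans³ : ∀ a b c → 0ℤ ≤ trans³ a b c
  0≤trans³ = from-yes (∀Rel? λ a → ∀Rel? λ b → ∀Rel? λ c → 0ℤ ≤? trans³ a b c)

  0≤i*j : ∀ {i j} → 0ℤ ≤ i → 0ℤ ≤ j → 0ℤ ≤ i * j
  0≤i*j {+ m} _ 0≤j = 0≤*ˡ m 0≤j

  -- Nonnegative combinations and averaging.

  -- Inequalities are proved by writing the difference of their sides as a sum of evidently nonnegative terms; the
  -- equality is left to the ring solver.
  infixr 5 _⊕_
  _⊕_ : ∀ {i j} → 0ℤ ≤ i → 0ℤ ≤ j → 0ℤ ≤ i + j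
  _⊕_ = +-mono-≤

  ≤-by : ∀ {i j d} → 0ℤ ≤ d → d ≡ j - i → i ≤ j
  ≤-by 0≤d refl = 0≤i-j⇒j≤i 0≤d

  ∑≥0 : ∀ {n} {f : Fin n → ℤ} → (∀ i → 0ℤ ≤ f i) → 0ℤ ≤ ∑ f
  ∑≥0 {n} {f} 0≤f = subst (_≤ ∑ f) (trans (∑-const n 0ℤ) (*-zeroʳ (+ n))) (∑-mono 0≤f)

  ∃-≤-average : ∀ {n} (f : Fin n → ℤ) m → .{{ℕ.NonZero n}} → ∑ f ≤ + n * m → Σ (Fin n) λ u → f u ≤ m
  ∃-≤-average {n} f m ∑f≤ with any? (λ u → f u ≤? m)
  ... | yes found = found
  ... | no  none  = contradiction
    (≤-trans (≤-trans (≤-reflexive (sym (∑-const n (sucℤ m)))) (∑-mono λ u → i<j⇒suc[i]≤j (≰⇒> λ p → none (u , p)))) ∑f≤)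
    (<⇒≱ (*-monoˡ-<-pos (+ n) {{pos n}} (i<suc[i])))
    where
    pos : ∀ n .{{_ : ℕ.NonZero n}} → Positive (+ n)
    pos (ℕ.suc n) = _
    i<suc[i] : m < sucℤ m
    i<suc[i] = subst (_< sucℤ m) (+-identityˡ m) (+-monoˡ-< m (+<+ (ℕ.s≤s z≤n)))

  doubled : ∀ {n} (f : Fin n → Fin n → ℤ) → ∑ (λ x → ∑ λ y → f x y + f y x) ≡ + 2 * ∑ (λ x → ∑ (f x))
  doubled f = trans (∑∑-+ f (λ x y → f y x))
    (trans (cong (λ s → ∑ (λ x → ∑ (f x)) + s) (∑-comm (λ x y → f y x))) (twice (∑ λ x → ∑ (f x))))
    where
    twice : ∀ s → s + s ≡ + 2 * s
    twice = solve-∀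

  -- Few wrong pairs for the parts given by a typical vertex.

  module Rounding {n : ℕ} .{{_ : ℕ.NonZero n}} (r : Fin n → Fin n → Rel) (r-inv : ∀ u v → r v u ≡ inv (r u v)) where
    open Density r r-inv

    private N = + n

    instance
      N-pos : Positive (+ n)
      N-pos = positive (+<+ (ℕ.>-nonZero⁻¹ n))

    W : Fin n → ℤ
    W u = ∑ λ x → ∑ λ y → wrong (r u x) (r u y) (r x y)

    0≤T : ∀ u → 0ℤ ≤ T u
    0≤T u = ∑≥0 λ x → ∑≥0 λ y → 0≤trans³ (r u x) (r x y) (r u y)

    -- Put K = 25 k². Inserting the hypothesis into `TI-bound` cancels the main terms and leaves 2 K
    -- ∑ S ≤ 50 N³, where 50 is 5 times the excess 10.
    ∑S-bound : ∀ k → + 9 * (+ 25 * (k * k) * TI) ≤ (+ 25 * (k * k) + + 10) * (N * (N * N)) →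
               k * k * ∑ S ≤ N * (N * N)
    ∑S-bound k h = *-cancelˡ-≤-pos _ _ (+ 25) (*-cancelˡ-≤-pos _ _ (+ 2) (*-cancelˡ-≤-pos _ _ N
      (≤-by (0≤i*j 0≤K (i≤j⇒0≤j-i TI-bound) ⊕ 0≤i*j {N} (+≤+ z≤n) (0≤*ˡ 5 (i≤j⇒0≤j-i h)))
            (trans (lemma K N (∑ S) TI) (cong (λ s → N * (+ 2 * (+ 25 * (N * (N * N)))) - N * (+ 2 * s)) (*-assoc (+ 25) (k * k) (∑ S)))))))
      where
      K : ℤ
      K = + 25 * (k * k)
      0≤K : 0ℤ ≤ K
      0≤K = 0≤*ˡ 25 (0≤i*i k)
      lemma : ∀ K N s t →
        K * (+ 45 * (N * t) - N * (+ 5 * (N * (N * N)) + + 2 * s))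
          + N * (+ 5 * ((K + + 10) * (N * (N * N)) - + 9 * (K * t)))
        ≡ N * (+ 2 * (+ 25 * (N * (N * N)))) - N * (+ 2 * (K * s))
      lemma = solve-∀

    module _ (u : Fin n) where

      private
        α β : ℤ
        α = E⁺ u
        β = E⁻ u
        c : Fin n → Rel
        c = r u
        X : Fin n → ℤ
        X x = wt⁺ (c x) * E⁺ x + wt⁻ (c x) * E⁻ x

      opaque
        unfolding cost budget

        ∑cost : ∑ (λ x → ∑ λ y → cost (c x) (c y) (r x y)) ≡
                + 9 * W u + N * (+ 7 * α + + 5 * β) + (+ 3 * (α * α) + + 4 * (α * β) + + 2 * (β * β))
        ∑cost = trans (∑∑-+ (λ x y → + 9 * wrong (c x) (c y) (r x y) + (+ 7 * e⁺ (c x) + + 5 * e⁻ (c x)))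
                            (λ x y → q x y + + 2 * (e⁻ (c x) * e⁻ (c y))))
          (cong₂ _+_
            (trans (∑∑-+ (λ x y → + 9 * wrong (c x) (c y) (r x y)) (λ x _ → + 7 * e⁺ (c x) + + 5 * e⁻ (c x)))
              (cong₂ _+_ (∑∑-*ˡ (+ 9) (λ x y → wrong (c x) (c y) (r x y)))
                (trans (sum-cong-≗ λ x → ∑-const n (+ 7 * e⁺ (c x) + + 5 * e⁻ (c x)))
                  (trans (∑-*ˡ N (λ x → + 7 * e⁺ (c x) + + 5 * e⁻ (c x)))
                    (cong (λ s → N * s) (trans (∑-distrib-+ (λ x → + 7 * e⁺ (c x)) (λ x → + 5 * e⁻ (c x)))
                      (cong₂ _+_ (∑-*ˡ (+ 7) (λ x → e⁺ (c x))) (∑-*ˡ (+ 5) (λ x → e⁻ (c x))))))))))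
            (trans (∑∑-+ q (λ x y → + 2 * (e⁻ (c x) * e⁻ (c y))))
              (cong₂ _+_ (trans (∑∑-+ (λ x y → + 3 * (e⁺ (c x) * e⁺ (c y))) (λ x y → + 4 * (e⁺ (c x) * e⁻ (c y))))
                (cong₂ _+_ (bilinear 3 e⁺ e⁺) (bilinear 4 e⁺ e⁻))) (bilinear 2 e⁻ e⁻))))
          where
          q : Fin n → Fin n → ℤ
          q x y = + 3 * (e⁺ (c x) * e⁺ (c y)) + + 4 * (e⁺ (c x) * e⁻ (c y))
          bilinear : ∀ k (f g : Rel → ℤ) →
            ∑ (λ x → ∑ λ y → + k * (f (c x) * g (c y))) ≡ + k * (∑ (λ x → f (c x)) * ∑ (λ x → g (c x)))
          bilinear k f g = trans (∑∑-*ˡ (+ k) (λ x y → f (c x) * g (c y))) (cong (λ s → + k * s) (∑∑-* (λ x → f (c x)) (λ y → g (c y))))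

        ∑budget : ∑ (λ x → ∑ λ y → budget (c x) (c y) (r x y)) ≡ + 36 * T u + + 3 * ∑ X
        ∑budget = trans (∑∑-+ (λ x y → + 36 * t x y) (λ x y → + 3 * z x y))
          (cong₂ _+_ (∑∑-*ˡ (+ 36) t) (trans (∑∑-*ˡ (+ 3) z) (cong (λ s → + 3 * s) (sum-cong-≗ λ x →
            trans (∑-distrib-+ (λ y → wt⁺ (c x) * e⁺ (r x y)) (λ y → wt⁻ (c x) * e⁻ (r x y)))
              (cong₂ _+_ (∑-*ˡ (wt⁺ (c x)) (λ y → e⁺ (r x y))) (∑-*ˡ (wt⁻ (c x)) (λ y → e⁻ (r x y))))))))
          where
          t z : Fin n → Fin n → ℤ
          t x y = trans³ (c x) (r x y) (c y)
          z x y = wt⁺ (c x) * e⁺ (r x y) + wt⁻ (c x) * e⁻ (r x y)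

      9W-bound : + 9 * W u + N * (+ 7 * α + + 5 * β) + (+ 3 * (α * α) + + 4 * (α * β) + + 2 * (β * β))
                 ≤ + 36 * T u + + 3 * ∑ X
      9W-bound = subst₂ _≤_ ∑cost ∑budget (*-cancelˡ-≤-pos _ _ (+ 2)
        (subst₂ _≤_ (doubled (λ x y → cost (c x) (c y) (r x y))) (doubled (λ x y → budget (c x) (c y) (r x y)))
          (∑-mono λ x → ∑-mono λ y → subst (λ ρ → cost (c x) (c y) (r x y) + cost (c y) (c x) ρ ≤
            budget (c x) (c y) (r x y) + budget (c y) (c x) ρ) (sym (r-inv x y)) (cost≤budget (c x) (c y) (r x y)))))

      -- 2 (k E)(w N) ≤ (k E)² + (w N)² replaces the Cauchy–Schwarz inequality and avoids square roots.
      X-bound : ∀ k x → + 2 * (k * (N * X x)) ≤ k * k * S x + + 20 * (N * N)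
      X-bound k x = ≤-by
        (0≤i*i (k * E⁺ x - wt⁺ (c x) * N) ⊕ 0≤i*i (k * E⁻ x - wt⁻ (c x) * N)
          ⊕ 0≤i*j (i≤j⇒0≤j-i (wt⁺²≤4 (c x))) (0≤i*i N) ⊕ 0≤i*j (i≤j⇒0≤j-i (wt⁻²≤16 (c x))) (0≤i*i N)
          ⊕ 0≤i*j (0≤i*i k) (0≤T x))
        (lemma k N (E⁺ x) (E⁻ x) (wt⁺ (c x)) (wt⁻ (c x)) (T x))
        where
        lemma : ∀ k N a b v w t →
          (k * a - v * N) * (k * a - v * N) + ((k * b - w * N) * (k * b - w * N)
            + ((+ 4 - v * v) * (N * N) + ((+ 16 - w * w) * (N * N) + k * k * t)))
          ≡ k * k * (t + a * a + b * b) + + 20 * (N * N) - + 2 * (k * (N * (v * a + w * b)))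
        lemma = solve-∀

      ∑X-bound : ∀ k → + 2 * (k * (N * ∑ X)) ≤ k * k * ∑ S + + 20 * (N * (N * N))
      ∑X-bound k = subst₂ _≤_
        (trans (∑-*ˡ (+ 2) (λ x → k * (N * X x))) (cong (λ s → + 2 * s)
          (trans (∑-*ˡ k (λ x → N * X x)) (cong (λ s → k * s) (∑-*ˡ N X)))))
        (trans (∑-distrib-+ (λ x → k * k * S x) (λ _ → + 20 * (N * N)))
          (cong₂ _+_ (∑-*ˡ (k * k) S) (trans (∑-const n (+ 20 * (N * N))) (lemma N))))
        (∑-mono (X-bound k))
        where
        lemma : ∀ N → N * (+ 20 * (N * N)) ≡ + 20 * (N * (N * N))
        lemma = solve-∀

      W-bound : ∀ k → 0ℤ ≤ k - + 1 → k * k * ∑ S ≤ N * (N * N) → k * k * S u ≤ N * N → k * W u ≤ + 12 * (N * N)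
      W-bound k 1≤k hΣ hu = *-cancelˡ-≤-pos _ _ (+ 18) (*-cancelˡ-≤-pos _ _ N (≤-by
        ( 0≤i*j (0≤*ˡ 2 (0≤i*j 0≤k (+≤+ {0} {n} z≤n))) (i≤j⇒0≤j-i 9W-bound)
        ⊕ 0≤*ˡ 3 (i≤j⇒0≤j-i (∑X-bound k))
        ⊕ 0≤*ˡ 3 (i≤j⇒0≤j-i hΣ)
        ⊕ 0≤i*j {N} (+≤+ z≤n) (0≤i*i (k * α + + 7 * N) ⊕ 0≤i*i (k * β + + 5 * N) ⊕ 0≤*ˡ 72 (i≤j⇒0≤j-i hu)
             ⊕ 0≤*ˡ 71 (0≤i*j (0≤i*i k) (0≤i*i α)) ⊕ 0≤*ˡ 71 (0≤i*j (0≤i*i k) (0≤i*i β))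
             ⊕ 0≤*ˡ 72 (0≤i*j 0≤k (0≤i*j 1≤k (0≤T u)))
             ⊕ 0≤*ˡ 2 (0≤i*j 0≤k (0≤i*i α ⊕ 0≤*ˡ 2 (0≤i*i (α + β))))
             ⊕ 0≤*ˡ 7 (0≤i*i N)))
        (lemma k N (W u) (T u) α β (∑ X) (∑ S))))
        where
        0≤k : 0ℤ ≤ k
        0≤k = ≤-by (1≤k ⊕ +≤+ {0} {1} z≤n) (lemma₀ k)
          where
          lemma₀ : ∀ k → k - + 1 + + 1 ≡ k - + 0
          lemma₀ = solve-∀
        lemma : ∀ k N w t a b x s →
          + 2 * (k * N) * (+ 36 * t + + 3 * x - (+ 9 * w + N * (+ 7 * a + + 5 * b) + (+ 3 * (a * a) + + 4 * (a * b) + + 2 * (b * b))))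
          + (+ 3 * (k * k * s + + 20 * (N * (N * N)) - + 2 * (k * (N * x)))
          + (+ 3 * (N * (N * N) - k * k * s)
          + N * ((k * a + + 7 * N) * (k * a + + 7 * N) + ((k * b + + 5 * N) * (k * b + + 5 * N)
              + (+ 72 * (N * N - k * k * (t + a * a + b * b))
              + (+ 71 * (k * k * (a * a)) + (+ 71 * (k * k * (b * b)) + (+ 72 * (k * ((k - + 1) * t))
              + (+ 2 * (k * (a * a + + 2 * ((a + b) * (a + b)))) + + 7 * (N * N))))))))))
          ≡ N * (+ 18 * (+ 12 * (N * N))) - N * (+ 18 * (k * w))
        lemma = solve-∀

  -- Sorting the vertices by parts.

  select : Bool → Bool → Rel
  select a s = if a then non else if s then fwd else bwd

  partAt : (z s j : ℕ) → Rel
  partAt z s j = select (j <ᵇ z) (j <ᵇ s)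

  m≤n⇒n≮ᵇm : ∀ {m n} → m ℕ.≤ n → (n <ᵇ m) ≡ false
  m≤n⇒n≮ᵇm z≤n       = refl
  m≤n⇒n≮ᵇm (s≤s m≤n) = m≤n⇒n≮ᵇm m≤n

  m≤n⇒m<ᵇ1+n : ∀ {m n} → m ℕ.≤ n → (m <ᵇ ℕ.suc n) ≡ true
  m≤n⇒m<ᵇ1+n z≤n       = refl
  m≤n⇒m<ᵇ1+n (s≤s m≤n) = m≤n⇒m<ᵇ1+n m≤n

  -- When `sort` puts a new vertex at position i, older positions from i on move up by one, so a
  -- threshold at or above i must rise by one to cut the older vertices at the same place.
  punchIn-<ᵇ-suc : ∀ {n t} (i : Fin (ℕ.suc n)) j → toℕ i ℕ.≤ t → (toℕ (punchIn i j) <ᵇ ℕ.suc t) ≡ (toℕ j <ᵇ t)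
  punchIn-<ᵇ-suc zero    j       _         = refl
  punchIn-<ᵇ-suc (suc i) zero    (s≤s i≤t) = refl
  punchIn-<ᵇ-suc (suc i) (suc j) (s≤s i≤t) = punchIn-<ᵇ-suc i j i≤t

  punchIn-<ᵇ : ∀ {n} t (i : Fin (ℕ.suc n)) j → t ℕ.≤ toℕ i → (toℕ (punchIn i j) <ᵇ t) ≡ (toℕ j <ᵇ t)
  punchIn-<ᵇ ℕ.zero    i       j       _         = refl
  punchIn-<ᵇ (ℕ.suc t) (suc i) zero    _         = refl
  punchIn-<ᵇ (ℕ.suc t) (suc i) (suc j) (s≤s t≤i) = punchIn-<ᵇ t i j t≤i

  -- z = |V₀| and s = |V₀| + |V₁|, with the sizes stated through 3 |V₁| = n + ∑ e⁺ and 3 |V₂| = n + ∑ e⁻.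
  record Sorting {n : ℕ} (c : Fin n → Rel) : Set where
    field
      z s    : ℕ
      z≤s    : z ℕ.≤ s
      s≤n    : s ℕ.≤ n
      σ      : Permutation′ n
      sorted : ∀ v → partAt z s (toℕ (σ ⟨$⟩ʳ v)) ≡ c v
      z-size : + 3 * + z + (∑ (λ v → e⁺ (c v)) + ∑ (λ v → e⁻ (c v))) ≡ + n
      s-size : + 3 * + s + ∑ (λ v → e⁻ (c v)) ≡ + 2 * + n

  -- Induction on n: the new vertex is inserted at the front of its own part, at position 0, z or s.
  sort : ∀ {n} (c : Fin n → Rel) → Sorting c
  sort {ℕ.zero} c = record
    { z = 0 ; s = 0 ; z≤s = z≤n ; s≤n = z≤n ; σ = idₚ ; sorted = λ () ; z-size = refl ; s-size = refl }
  sort {ℕ.suc n} c = extend (c zero) refl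
    where
    open Sorting (sort (λ v → c (suc v)))
    A B : ℤ
    A = ∑ (λ v → e⁺ (c (suc v)))
    B = ∑ (λ v → e⁻ (c (suc v)))
    lemma₃ : ∀ n → + 2 + + 2 * n ≡ + 2 * (+ 1 + n)
    lemma₃ = solve-∀
    extended : ∀ z′ s′ (i : Fin (ℕ.suc n)) → partAt z′ s′ (toℕ i) ≡ c zero →
      (∀ j → partAt z′ s′ (toℕ (punchIn i j)) ≡ partAt z s (toℕ j)) →
      ∀ v → partAt z′ s′ (toℕ (insert zero i σ ⟨$⟩ʳ v)) ≡ c v
    extended z′ s′ i new old zero    = new
    extended z′ s′ i new old (suc v) = trans (cong (λ j → partAt z′ s′ (toℕ j)) (insert-punchIn zero i σ v))
      (trans (old (σ ⟨$⟩ʳ v)) (sorted v))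
    extend : ∀ c₀ → c zero ≡ c₀ → Sorting c
    extend non eq = record
      { z = ℕ.suc z ; s = ℕ.suc s ; z≤s = s≤s z≤s ; s≤n = s≤s s≤n ; σ = insert zero zero σ
      ; sorted = extended (ℕ.suc z) (ℕ.suc s) zero (sym eq) λ j → refl
      ; z-size = trans (cong (λ ρ → + 3 * + ℕ.suc z + (e⁺ ρ + A + (e⁻ ρ + B))) eq)
          (trans (lemma₁ (+ z) A B) (cong (λ m → + 1 + m) z-size))
      ; s-size = trans (cong (λ ρ → + 3 * + ℕ.suc s + (e⁻ ρ + B)) eq)
          (trans (lemma₂ (+ s) B) (trans (cong (λ m → + 2 + m) s-size) (lemma₃ (+ n)))) }
      where
      lemma₁ : ∀ z A B → + 3 * (+ 1 + z) + (- + 1 + A + (- + 1 + B)) ≡ + 1 + (+ 3 * z + (A + B))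
      lemma₁ = solve-∀
      lemma₂ : ∀ s B → + 3 * (+ 1 + s) + (- + 1 + B) ≡ + 2 + (+ 3 * s + B)
      lemma₂ = solve-∀
    extend fwd eq = record
      { z = z ; s = ℕ.suc s ; z≤s = ℕ.m≤n⇒m≤1+n z≤s ; s≤n = s≤s s≤n ; σ = insert zero p σ
      ; sorted = extended z (ℕ.suc s) p
          (trans (cong (partAt z (ℕ.suc s)) p≡z)
            (trans (cong₂ select (m≤n⇒n≮ᵇm (ℕ.≤-refl {z})) (m≤n⇒m<ᵇ1+n z≤s)) (sym eq)))
          λ j → cong₂ select (punchIn-<ᵇ z p j (ℕ.≤-reflexive (sym p≡z)))
                             (punchIn-<ᵇ-suc p j (ℕ.≤-trans (ℕ.≤-reflexive p≡z) z≤s))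
      ; z-size = trans (cong (λ ρ → + 3 * + z + (e⁺ ρ + A + (e⁻ ρ + B))) eq)
          (trans (lemma₁ (+ z) A B) (cong (λ m → + 1 + m) z-size))
      ; s-size = trans (cong (λ ρ → + 3 * + ℕ.suc s + (e⁻ ρ + B)) eq)
          (trans (lemma₂ (+ s) B) (trans (cong (λ m → + 2 + m) s-size) (lemma₃ (+ n)))) }
      where
      z<1+n = s≤s (ℕ.≤-trans z≤s s≤n)
      p = fromℕ< z<1+n
      p≡z = toℕ-fromℕ< z<1+n
      lemma₁ : ∀ z A B → + 3 * z + (+ 2 + A + (- + 1 + B)) ≡ + 1 + (+ 3 * z + (A + B))
      lemma₁ = solve-∀
      lemma₂ : ∀ s B → + 3 * (+ 1 + s) + (- + 1 + B) ≡ + 2 + (+ 3 * s + B)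
      lemma₂ = solve-∀
    extend bwd eq = record
      { z = z ; s = s ; z≤s = z≤s ; s≤n = ℕ.m≤n⇒m≤1+n s≤n ; σ = insert zero p σ
      ; sorted = extended z s p
          (trans (cong (partAt z s) p≡s)
            (trans (cong₂ select (m≤n⇒n≮ᵇm z≤s) (m≤n⇒n≮ᵇm (ℕ.≤-refl {s}))) (sym eq)))
          λ j → cong₂ select (punchIn-<ᵇ z p j (ℕ.≤-trans z≤s (ℕ.≤-reflexive (sym p≡s))))
                             (punchIn-<ᵇ s p j (ℕ.≤-reflexive (sym p≡s)))
      ; z-size = trans (cong (λ ρ → + 3 * + z + (e⁺ ρ + A + (e⁻ ρ + B))) eq)
          (trans (lemma₁ (+ z) A B) (cong (λ m → + 1 + m) z-size))
      ; s-size = trans (cong (λ ρ → + 3 * + s + (e⁻ ρ + B)) eq)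
          (trans (lemma₂ (+ s) B) (trans (cong (λ m → + 2 + m) s-size) (lemma₃ (+ n)))) }
      where
      p = fromℕ< (s≤s s≤n)
      p≡s = toℕ-fromℕ< (s≤s s≤n)
      lemma₁ : ∀ z A B → + 3 * z + (- + 1 + A + (+ 2 + B)) ≡ + 1 + (+ 3 * z + (A + B))
      lemma₁ = solve-∀
      lemma₂ : ∀ s B → + 3 * s + (+ 2 + B) ≡ + 2 + (+ 3 * s + B)
      lemma₂ = solve-∀

  -- Adjusting the part sizes to those of B_n.

  ∑-threshold : ∀ n a b → ∑ {n} (λ j → 𝟙ℤ ((toℕ j <ᵇ a) xor (toℕ j <ᵇ b))) ≤ + ∣ a - b ∣
  ∑-threshold ℕ.zero    a         b         = +≤+ z≤n
  ∑-threshold (ℕ.suc n) ℕ.zero    ℕ.zero    = subst (_≤ 0ℤ) (sym (+-identityˡ _)) (∑-threshold n 0 0)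
  ∑-threshold (ℕ.suc n) ℕ.zero    (ℕ.suc b) = +-monoʳ-≤ (+ 1) (∑-threshold n 0 b)
  ∑-threshold (ℕ.suc n) (ℕ.suc a) ℕ.zero    = +-monoʳ-≤ (+ 1) (≤-trans (∑-threshold n a 0) (≤-reflexive (cong +_ (ℕ.∣-∣-identityʳ a))))
  ∑-threshold (ℕ.suc n) (ℕ.suc a) (ℕ.suc b) = subst (_≤ + ∣ a - b ∣) (sym (+-identityˡ _)) (∑-threshold n a b)

  -- Lets `d-bound` treat the distance as an unknown that is controlled through its square, a
  -- polynomial in a and b.
  ∣-∣-square : ∀ a b → + ∣ a - b ∣ * + ∣ a - b ∣ ≡ (+ a - + b) * (+ a - + b)
  ∣-∣-square ℕ.zero    b         = lemma (+ b)
    where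
    lemma : ∀ b → b * b ≡ (+ 0 - b) * (+ 0 - b)
    lemma = solve-∀
  ∣-∣-square (ℕ.suc a) ℕ.zero    = cong (λ s → s * s) (sym (+-identityʳ (+ ℕ.suc a)))
  ∣-∣-square (ℕ.suc a) (ℕ.suc b) = trans (∣-∣-square a b) (lemma (+ a) (+ b))
    where
    lemma : ∀ a b → (a - b) * (a - b) ≡ (+ 1 + a - (+ 1 + b)) * (+ 1 + a - (+ 1 + b))
    lemma = solve-∀

  index : Rel → ℕ
  index non = 0
  index fwd = 1
  index bwd = 2

  differ : Rel → Rel → ℤ
  differ c d = 𝟙ℤ (not (index c ℕ.≡ᵇ index d))

  part-select : ∀ {n} (v : Fin n) → part v ≡ index (partAt (n / 3) (n / 3 ℕ.+ (n ℕ.+ 1) / 3) (toℕ v))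
  part-select {n} v with toℕ v <ᵇ n / 3 | toℕ v <ᵇ (n / 3 ℕ.+ (n ℕ.+ 1) / 3)
  ... | true  | _     = refl
  ... | false | true  = refl
  ... | false | false = refl

  succ?-index : ∀ c d → (index d ℕ.≡ᵇ next3 (index c)) ≡ succ? c d
  succ?-index = from-yes (∀Rel? λ c → ∀Rel? λ d → (index d ℕ.≡ᵇ next3 (index c)) Bool.≟ succ? c d)

  wrong-differ : ∀ b b′ r c c′ → wrong b b′ r ≤ wrong c c′ r + (differ b c + differ b′ c′)
  wrong-differ = from-yes (∀Rel? λ b → ∀Rel? λ b′ → ∀Rel? λ r → ∀Rel? λ c → ∀Rel? λ c′ →
    wrong b b′ r ≤? wrong c c′ r + (differ b c + differ b′ c′))

  0≤𝟙ℤ : ∀ b → 0ℤ ≤ 𝟙ℤ b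
  0≤𝟙ℤ b = +≤+ z≤n

  differ≤1 : ∀ c d → differ c d ≤ + 1
  differ≤1 = from-yes (∀Rel? λ c → ∀Rel? λ d → differ c d ≤? + 1)

  differ-select : ∀ p q p′ q′ → differ (select p q) (select p′ q′) ≤ 𝟙ℤ (p xor p′) + 𝟙ℤ (q xor q′)
  differ-select true  q     true  q′    = +-monoʳ-≤ 0ℤ (0≤𝟙ℤ (q xor q′))
  differ-select true  q     false q′    = ≤-trans (differ≤1 non (select false q′)) (+-monoʳ-≤ (+ 1) (0≤𝟙ℤ (q xor q′)))
  differ-select false q     true  q′    = ≤-trans (differ≤1 (select false q) non) (+-monoʳ-≤ (+ 1) (0≤𝟙ℤ (q xor q′)))
  differ-select false true  false true  = ≤-refl
  differ-select false true  false false = ≤-refl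
  differ-select false false false true  = ≤-refl
  differ-select false false false false = ≤-refl

  module Balancing {n : ℕ} .{{_ : ℕ.NonZero n}} (r : Fin n → Fin n → Rel) (r-inv : ∀ u v → r v u ≡ inv (r u v))
    (u : Fin n) where
    open Density r r-inv
    open Rounding r r-inv
    open Sorting (sort (r u)) public

    private
      N = + n
      z₀ = n / 3
      s₀ = n / 3 ℕ.+ (n ℕ.+ 1) / 3

    -- The part of B_n that receives v once the vertices are sorted. Old and new parts cut the same
    -- order at two thresholds each, so at most `d` vertices change part.
    target : Fin n → Rel
    target v = partAt z₀ s₀ (toℕ (σ ⟨$⟩ʳ v))

    d : ℕ
    d = ∣ z₀ - z ∣ ℕ.+ ∣ s₀ - s ∣

    ∑differ : ∑ (λ v → differ (target v) (r u v)) ≤ + d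
    ∑differ = begin
      ∑ (λ v → differ (target v) (r u v))
        ≡⟨ sum-cong-≗ (λ v → cong (differ (target v)) (sym (sorted v))) ⟩
      ∑ (λ v → δ (σ ⟨$⟩ʳ v)) ≡⟨ sym (sum-permute δ σ) ⟩
      ∑ δ ≤⟨ ∑-mono {n} {δ} (λ j → differ-select (toℕ j <ᵇ z₀) (toℕ j <ᵇ s₀) (toℕ j <ᵇ z) (toℕ j <ᵇ s)) ⟩
      ∑ {n} (λ j → 𝟙ℤ ((toℕ j <ᵇ z₀) xor (toℕ j <ᵇ z)) + 𝟙ℤ ((toℕ j <ᵇ s₀) xor (toℕ j <ᵇ s)))
        ≡⟨ ∑-distrib-+ {n} (λ j → 𝟙ℤ ((toℕ j <ᵇ z₀) xor (toℕ j <ᵇ z))) (λ j → 𝟙ℤ ((toℕ j <ᵇ s₀) xor (toℕ j <ᵇ s))) ⟩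
      ∑ {n} (λ j → 𝟙ℤ ((toℕ j <ᵇ z₀) xor (toℕ j <ᵇ z))) + ∑ {n} (λ j → 𝟙ℤ ((toℕ j <ᵇ s₀) xor (toℕ j <ᵇ s)))
        ≤⟨ +-mono-≤ (∑-threshold n z₀ z) (∑-threshold n s₀ s) ⟩
      + d ∎
      where
      open ≤-Reasoning
      δ : Fin n → ℤ
      δ j = differ (partAt z₀ s₀ (toℕ j)) (partAt z s (toℕ j))

    edits : ℤ
    edits = ∑ λ x → ∑ λ y → wrong (target x) (target y) (r x y)

    -- A moved vertex is charged N times as first and N times as second member of a pair.
    edits≤W+2Nd : edits ≤ W u + + 2 * (N * + d)
    edits≤W+2Nd = begin
      edits
        ≤⟨ (∑-mono λ x → ∑-mono λ y → wrong-differ (target x) (target y) (r x y) (r u x) (r u y)) ⟩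
      ∑ (λ x → ∑ λ y → wrong (r u x) (r u y) (r x y) + (D x + D y))
        ≡⟨ ∑∑-+ (λ x y → wrong (r u x) (r u y) (r x y)) (λ x y → D x + D y) ⟩
      W u + ∑ (λ x → ∑ λ y → D x + D y)
        ≡⟨ cong (λ s → W u + s) (trans (∑∑-+ {n} {n} (λ x _ → D x) (λ _ y → D y))
             (trans (cong₂ _+_ (trans (sum-cong-≗ λ x → ∑-const n (D x)) (∑-*ˡ N D)) (∑-const n (∑ D))) (twice (N * ∑ D)))) ⟩
      W u + + 2 * (N * ∑ D)
        ≤⟨ +-monoʳ-≤ (W u) (*-monoˡ-≤-nonNeg (+ 2) (*-monoˡ-≤-nonNeg N ∑differ)) ⟩
      W u + + 2 * (N * + d) ∎
      where
      open ≤-Reasoning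
      D : Fin n → ℤ
      D v = differ (target v) (r u v)
      twice : ∀ s → s + s ≡ + 2 * s
      twice = solve-∀

    -- Here 3 d₁ = |α + β - ρ| and 3 d₂ = |β + τ|, with rounding terms ρ² ≤ 4 and τ² ≤ 9. Completing
    -- squares in 3 k d₁ and 3 k d₂ costs 2 N², the degrees cost 6 N² through `S u`, and the
    -- rounding costs (2 · 4 + 2 · 9) k² ≤ 26 N². With 2 N² to spare this makes 36 N².
    d-bound : ∀ k → 0ℤ ≤ k → k ≤ N → k * k * S u ≤ N * N → k * + d ≤ + 6 * N
    d-bound k 0≤k k≤N hu = *-cancelˡ-≤-pos _ _ (+ 6) (*-cancelˡ-≤-pos _ _ N {{N-pos}} (≤-by
      ( 0≤i*i (+ 3 * (k * d₁) - N) ⊕ 0≤i*i (+ 3 * (k * d₂) - N)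
      ⊕ 0≤i*j (0≤i*i k) (i≤j⇒0≤j-i (≤-reflexive d₁²) ⊕ i≤j⇒0≤j-i (≤-reflexive d₂²)
           ⊕ 0≤i*i (α + β + ρ) ⊕ 0≤*ˡ 2 (0≤i*i (α - β)) ⊕ 0≤i*i (β - τ) ⊕ 0≤*ˡ 2 (0≤i*i α) ⊕ 0≤*ˡ 6 (0≤T u)
           ⊕ 0≤*ˡ 2 (i≤j⇒0≤j-i ρ²≤4) ⊕ 0≤*ˡ 2 (i≤j⇒0≤j-i τ²≤9))
      ⊕ 0≤*ˡ 6 (i≤j⇒0≤j-i hu)
      ⊕ 0≤*ˡ 26 (0≤i*j (i≤j⇒0≤j-i k≤N) (+-mono-≤ (+≤+ {0} {n} z≤n) 0≤k))
      ⊕ 0≤*ˡ 2 (0≤i*i N))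
      (lemma k N d₁ d₂ α β ρ τ (T u))))
      where
      α β d₁ d₂ ρ τ : ℤ
      α = E⁺ u
      β = E⁻ u
      d₁ = + ∣ z₀ - z ∣
      d₂ = + ∣ s₀ - s ∣
      ρ = + (n % 3)
      τ = + 1 - (+ (n % 3) + + ((n ℕ.+ 1) % 3))
      third : ∀ m → + m ≡ + (m % 3) + + 3 * + (m / 3)
      third m = trans (cong +_ (m≡m%n+[m/n]*n m 3))
        (cong (λ s → + (m % 3) + s) (trans (pos-* (m / 3) 3) (*-comm (+ (m / 3)) (+ 3))))
      difference : ∀ {x x′ y y′ e} → + 3 * x + y ≡ e → + 3 * x′ + y′ ≡ e → + 3 * (x - x′) ≡ y′ - y
      difference {x} {x′} {y} {y′} {e} p q = trans (lemma₀ x x′ y y′)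
        (trans (cong₂ (λ a b → a - b + (y′ - y)) p q) (trans (cong (λ a → a + (y′ - y)) (+-inverseʳ e)) (+-identityˡ (y′ - y))))
        where
        lemma₀ : ∀ x x′ y y′ → + 3 * (x - x′) ≡ + 3 * x + y - (+ 3 * x′ + y′) + (y′ - y)
        lemma₀ = solve-∀
      9*∣-∣² : ∀ a b e → + 3 * (+ a - + b) ≡ e → + 9 * (+ ∣ a - b ∣ * + ∣ a - b ∣) ≡ e * e
      9*∣-∣² a b e eq = trans (cong (λ s → + 9 * s) (∣-∣-square a b)) (trans (lemma₀ (+ a - + b)) (cong (λ s → s * s) eq))
        where
        lemma₀ : ∀ x → + 9 * (x * x) ≡ + 3 * x * (+ 3 * x)
        lemma₀ = solve-∀
      d₁² : + 9 * (d₁ * d₁) ≡ (α + β - ρ) * (α + β - ρ)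
      d₁² = 9*∣-∣² z₀ z (α + β - ρ) (difference {+ z₀} {+ z} {ρ} {α + β} (trans (+-comm (+ 3 * + z₀) ρ) (sym (third n))) z-size)
      d₂² : + 9 * (d₂ * d₂) ≡ (β + τ) * (β + τ)
      d₂² = 9*∣-∣² s₀ s (β + τ) (trans (difference {+ s₀} {+ s} {+ 0 - τ} {β} s₀-size s-size) (lemma₀ β τ))
        where
        lemma₀ : ∀ β τ → β - (+ 0 - τ) ≡ β + τ
        lemma₀ = solve-∀
        lemma₁ : ∀ z x ρ ρ′ → + 3 * (z + x) + (+ 0 - (+ 1 - (ρ + ρ′))) ≡ ρ + + 3 * z + (ρ′ + + 3 * x) - + 1
        lemma₁ = solve-∀
        lemma₂ : ∀ n → n + (n + + 1) - + 1 ≡ + 2 * n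
        lemma₂ = solve-∀
        s₀-size : + 3 * + s₀ + (+ 0 - τ) ≡ + 2 * + n
        s₀-size = trans (lemma₁ (+ z₀) (+ ((n ℕ.+ 1) / 3)) ρ (+ ((n ℕ.+ 1) % 3)))
          (trans (cong₂ (λ a b → a + b - + 1) (sym (third n)) (sym (third (n ℕ.+ 1)))) (lemma₂ N))
      Small : ℕ → ℕ → Set
      Small a b = (+ a * + a ≤ + 4) × ((+ 1 - (+ a + + b)) * (+ 1 - (+ a + + b)) ≤ + 9)
      small? : ∀ a b → Dec (Small a b)
      small? a b = (+ a * + a ≤? + 4) ×-dec ((+ 1 - (+ a + + b)) * (+ 1 - (+ a + + b)) ≤? + 9)
      small : Small (n % 3) ((n ℕ.+ 1) % 3)
      small = subst₂ Small (toℕ-fromℕ< (m%n<n n 3)) (toℕ-fromℕ< (m%n<n (n ℕ.+ 1) 3))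
        (from-yes (all? {3} λ a → all? {3} λ b → small? (toℕ a) (toℕ b)) (fromℕ< (m%n<n n 3)) (fromℕ< (m%n<n (n ℕ.+ 1) 3)))
      ρ²≤4 : ρ * ρ ≤ + 4
      ρ²≤4 = proj₁ small
      τ²≤9 : τ * τ ≤ + 9
      τ²≤9 = proj₂ small
      lemma : ∀ k N x y a b p q t →
        (+ 3 * (k * x) - N) * (+ 3 * (k * x) - N) + ((+ 3 * (k * y) - N) * (+ 3 * (k * y) - N)
        + (k * k * ((a + b - p) * (a + b - p) - + 9 * (x * x) + ((b + q) * (b + q) - + 9 * (y * y)
           + ((a + b + p) * (a + b + p) + (+ 2 * ((a - b) * (a - b)) + ((b - q) * (b - q) + (+ 2 * (a * a) + (+ 6 * t
           + (+ 2 * (+ 4 - p * p) + + 2 * (+ 9 - q * q)))))))))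
        + (+ 6 * (N * N - k * k * (t + a * a + b * b))
        + (+ 26 * ((N - k) * (N + k)) + + 2 * (N * N)))))
        ≡ N * (+ 6 * (+ 6 * N)) - N * (+ 6 * (k * (x + y)))
      lemma = solve-∀

    -- `W u` contributes 12 and the moved vertices 2 · 6; the total 24 is the factor in the later
    -- choice k = 24 q.
    edits-bound : ∀ k → + 1 ≤ k → k ≤ N → k * k * ∑ S ≤ N * (N * N) → k * k * S u ≤ N * N →
                  k * edits ≤ + 24 * (N * N)
    edits-bound k 1≤k k≤N hΣ hu = ≤-by
      ( 0≤i*j 0≤k (i≤j⇒0≤j-i edits≤W+2Nd)
      ⊕ i≤j⇒0≤j-i (W-bound u k (i≤j⇒0≤j-i 1≤k) hΣ hu)
      ⊕ 0≤*ˡ 2 (0≤i*j {N} (+≤+ z≤n) (i≤j⇒0≤j-i (d-bound k 0≤k k≤N hu))))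
      (lemma k N edits (W u) (+ d))
      where
      0≤k = ≤-trans (+≤+ z≤n) 1≤k
      lemma : ∀ k N e w d → k * (w + + 2 * (N * d) - e) + (+ 12 * (N * N) - k * w + + 2 * (N * (+ 6 * N - k * d)))
        ≡ + 24 * (N * N) - k * e
      lemma = solve-∀

  -- Oriented graphs as relations.

  relOf : Bool → Bool → Rel
  -- Two opposite edges would be read as `fwd`; `rel-inv` excludes that case by `oriented`.
  relOf true  _     = fwd
  relOf false true  = bwd
  relOf false false = non

  module _ {n : ℕ} (G : OrientedGraph n) where

    rel : Fin n → Fin n → Rel
    rel u v = relOf (adj G u v) (adj G v u)

    rel-inv : ∀ u v → rel v u ≡ inv (rel u v)
    rel-inv u v = lemma (adj G u v) (adj G v u) (oriented G u v)
      where
      lemma : ∀ a b → (a ≡ true → b ≡ false) → relOf b a ≡ inv (relOf a b)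
      lemma true  true  h with () ← h refl
      lemma true  false h = refl
      lemma false true  h = refl
      lemma false false h = refl

    adj-rel : ∀ u v → adj G u v ≡ isFwd (rel u v)
    adj-rel u v = lemma (adj G u v) (adj G v u)
      where
      lemma : ∀ a b → a ≡ isFwd (relOf a b)
      lemma true  _     = refl
      lemma false true  = refl
      lemma false false = refl

    adj-rel-inv : ∀ u v → adj G v u ≡ isFwd (inv (rel u v))
    adj-rel-inv u v = trans (adj-rel v u) (cong isFwd (rel-inv u v))

  -- The conditions of `transitiveTriple` and `independentTriple` on six adjacency bits, so that
  -- comparing them with `trans³` and `indep³` is a check of 27 cases.
  transitive indep : (ab ba bc cb ac ca : Bool) → Bool
  transitive ab ba bc cb ac ca =
    (ab ∨ ba) ∧ (bc ∨ cb) ∧ (ac ∨ ca) ∧ not ((ab ∧ bc ∧ ca) ∨ (ac ∧ cb ∧ ba))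
  indep ab ba bc cb ac ca = not (ab ∨ ba) ∧ not (bc ∨ cb) ∧ not (ac ∨ ca)

  onRels : (Bool → Bool → Bool → Bool → Bool → Bool → Bool) → Rel → Rel → Rel → ℤ
  onRels f r s q = 𝟙ℤ (f (isFwd r) (isFwd (inv r)) (isFwd s) (isFwd (inv s)) (isFwd q) (isFwd (inv q)))

  onRels-adj : ∀ {n} (G : OrientedGraph n) f a b c →
    onRels f (rel G a b) (rel G b c) (rel G a c) ≡
    𝟙ℤ (f (adj G a b) (adj G b a) (adj G b c) (adj G c b) (adj G a c) (adj G c a))
  onRels-adj G f a b c
    rewrite sym (adj-rel G a b) | sym (adj-rel-inv G a b) | sym (adj-rel G b c)
          | sym (adj-rel-inv G b c) | sym (adj-rel G a c) | sym (adj-rel-inv G a c) = refl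

  trans³-onRels : ∀ r s q → trans³ r s q ≡ onRels transitive r s q
  trans³-onRels = from-yes (∀Rel? λ r → ∀Rel? λ s → ∀Rel? λ q → trans³ r s q ≟ onRels transitive r s q)

  indep³-onRels : ∀ r s q → indep³ r s q ≡ onRels indep r s q
  indep³-onRels = from-yes (∀Rel? λ r → ∀Rel? λ s → ∀Rel? λ q → indep³ r s q ≟ onRels indep r s q)

  trans³-transitiveTriple : ∀ {n} (G : OrientedGraph n) a b c →
    trans³ (rel G a b) (rel G b c) (rel G a c) ≡ 𝟙ℤ (transitiveTriple G a b c)
  trans³-transitiveTriple G a b c =
    trans (trans³-onRels (rel G a b) (rel G b c) (rel G a c)) (onRels-adj G transitive a b c)

  indep³-independentTriple : ∀ {n} (G : OrientedGraph n) a b c →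
    indep³ (rel G a b) (rel G b c) (rel G a c) ≡ 𝟙ℤ (independentTriple G a b c)
  indep³-independentTriple G a b c =
    trans (indep³-onRels (rel G a b) (rel G b c) (rel G a c)) (onRels-adj G indep a b c)

  -- From counts of unordered triples to sums over ordered triples.

  sum-allFin : ∀ n (f : Fin n → ℕ) → + sumᴸ (map f (allFin n)) ≡ ∑ (λ i → + f i)
  sum-allFin n f = trans (cong (λ l → + sumᴸ l) (map-tabulate (λ i → i) f)) (sum-tabulate n f)
    where
    sum-tabulate : ∀ n (f : Fin n → ℕ) → + sumᴸ (tabulate f) ≡ ∑ (λ i → + f i)
    sum-tabulate ℕ.zero    f = refl
    sum-tabulate (ℕ.suc n) f = cong (λ s → + f zero + s) (sum-tabulate n (λ i → f (suc i)))

  countPairs-∑ : ∀ {n} (P : Fin n → Fin n → Bool) →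
    + countPairs P ≡ ∑ λ u → ∑ λ v → 𝟙ℤ ((toℕ u <ᵇ toℕ v) ∧ P u v)
  countPairs-∑ {n} P = trans (sum-allFin n _) (sum-cong-≗ λ u → sum-allFin n (λ v → 𝟙 ((toℕ u <ᵇ toℕ v) ∧ P u v)))

  countTriples-∑ : ∀ {n} (P : Fin n → Fin n → Fin n → Bool) →
    + countTriples P ≡ ∑ λ a → ∑ λ b → ∑ λ c → 𝟙ℤ ((toℕ a <ᵇ toℕ b) ∧ (toℕ b <ᵇ toℕ c) ∧ P a b c)
  countTriples-∑ {n} P = trans (sum-allFin n _) (sum-cong-≗ λ a → trans (sum-allFin n _) (sum-cong-≗ λ b →
    sum-allFin n (λ c → 𝟙 ((toℕ a <ᵇ toℕ b) ∧ (toℕ b <ᵇ toℕ c) ∧ P a b c))))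

  -- The order of two indices is encoded as a `Rel`, so that facts mixing index order and adjacency
  -- are decided by the same kind of case check.
  compare : ℕ → ℕ → Rel
  compare ℕ.zero    ℕ.zero    = non
  compare ℕ.zero    (ℕ.suc _) = fwd
  compare (ℕ.suc _) ℕ.zero    = bwd
  compare (ℕ.suc a) (ℕ.suc b) = compare a b

  compare-inv : ∀ a b → compare b a ≡ inv (compare a b)
  compare-inv ℕ.zero    ℕ.zero    = refl
  compare-inv ℕ.zero    (ℕ.suc _) = refl
  compare-inv (ℕ.suc _) ℕ.zero    = refl
  compare-inv (ℕ.suc a) (ℕ.suc b) = compare-inv a b

  <ᵇ-compare : ∀ a b → (a <ᵇ b) ≡ isFwd (compare a b)
  <ᵇ-compare ℕ.zero    ℕ.zero    = refl
  <ᵇ-compare ℕ.zero    (ℕ.suc _) = refl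
  <ᵇ-compare (ℕ.suc _) ℕ.zero    = refl
  <ᵇ-compare (ℕ.suc a) (ℕ.suc b) = <ᵇ-compare a b

  isNon : Rel → ℤ
  isNon non = + 1
  isNon _   = + 0

  ∑-isNon : ∀ n a → ∑ {n} (λ j → isNon (compare a (toℕ j))) ≤ + 1
  ∑-isNon ℕ.zero    a         = +≤+ z≤n
  ∑-isNon (ℕ.suc n) ℕ.zero    = ≤-reflexive (cong (λ s → + 1 + s) (trans (∑-const n 0ℤ) (*-zeroʳ (+ n))))
  ∑-isNon (ℕ.suc n) (ℕ.suc a) = subst (_≤ + 1) (sym (+-identityˡ _)) (∑-isNon n a)

  ordered : Rel → Rel → ℤ
  ordered r s = 𝟙ℤ (isFwd r ∧ isFwd s)

  -- The six orderings of a triple (a, b, c): r, s, q are the results of comparing the indices of a and b, b and c, a and c,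
  -- and r′, s′, q′ are the corresponding relations in G.
  opaque
    orderings : (r s q r′ s′ q′ : Rel) → ℤ
    orderings r s q r′ s′ q′ =
        (ordered r s * ti r′ s′ q′ + ordered (inv r) q * ti (inv r′) q′ s′)
      + (ordered q (inv s) * ti q′ (inv s′) r′ + ordered (inv q) r * ti (inv q′) r′ (inv s′))
      + (ordered s (inv q) * ti s′ (inv q′) (inv r′) + ordered (inv s) (inv r) * ti (inv s′) (inv r′) (inv q′))

    -- With distinct indices some ordering is increasing, and `ti` takes the same value on all six;
    -- otherwise an `isNon` term pays, as `ti` is at most 1.
    ti≤orderings : ∀ r s q r′ s′ q′ → ti r′ s′ q′ ≤ orderings r s q r′ s′ q′ + (isNon r + isNon s + isNon q)
    ti≤orderings = from-yes (∀Rel? λ r → ∀Rel? λ s → ∀Rel? λ q → ∀Rel? λ r′ → ∀Rel? λ s′ → ∀Rel? λ q′ →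
      ti r′ s′ q′ ≤? orderings r s q r′ s′ q′ + (isNon r + isNon s + isNon q))

  module Counting {n : ℕ} .{{_ : ℕ.NonZero n}} (G : OrientedGraph n) where
    open Density (rel G) (rel-inv G)
    open Rounding (rel G) (rel-inv G) using (N-pos)

    private N = + n

    cT cI : ℕ
    cT = countTriples (transitiveTriple G)
    cI = countTriples (independentTriple G)

    private
      κ : Fin n → Fin n → Rel
      κ a b = compare (toℕ a) (toℕ b)

      g : Fin n → Fin n → Fin n → ℤ
      g a b c = ordered (κ a b) (κ b c) * ti (rel G a b) (rel G b c) (rel G a c)

      e : Fin n → Fin n → Fin n → ℤ
      e a b c = isNon (κ a b) + isNon (κ b c) + isNon (κ a c)

    ∑g : ∑ (λ a → ∑ λ b → ∑ λ c → g a b c) ≡ + cT + + cI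
    ∑g = sym (trans (cong₂ _+_ (countTriples-∑ (transitiveTriple G)) (countTriples-∑ (independentTriple G)))
      (trans (sym (trans (sum-cong-≗ λ a → ∑∑-+ (p a) (q a)) (∑-distrib-+ (λ a → ∑ λ b → ∑ (p a b)) (λ a → ∑ λ b → ∑ (q a b)))))
        (sum-cong-≗ λ a → sum-cong-≗ λ b → sum-cong-≗ λ c → sym (pointwise′ a b c))))
      where
      p q : Fin n → Fin n → Fin n → ℤ
      p a b c = 𝟙ℤ ((toℕ a <ᵇ toℕ b) ∧ (toℕ b <ᵇ toℕ c) ∧ transitiveTriple G a b c)
      q a b c = 𝟙ℤ ((toℕ a <ᵇ toℕ b) ∧ (toℕ b <ᵇ toℕ c) ∧ independentTriple G a b c)
      lemma : ∀ x y s t → 𝟙ℤ (x ∧ y) * (𝟙ℤ s + 𝟙ℤ t) ≡ 𝟙ℤ (x ∧ y ∧ s) + 𝟙ℤ (x ∧ y ∧ t)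
      lemma true  true  s t = *-identityˡ _
      lemma true  false s t = refl
      lemma false y     s t = refl
      pointwise′ : ∀ a b c → g a b c ≡ p a b c + q a b c
      pointwise′ a b c = trans (cong₂ _*_
          (sym (cong₂ (λ x y → 𝟙ℤ (x ∧ y)) (<ᵇ-compare (toℕ a) (toℕ b)) (<ᵇ-compare (toℕ b) (toℕ c))))
          (cong₂ _+_ (trans³-transitiveTriple G a b c) (indep³-independentTriple G a b c)))
        (lemma (toℕ a <ᵇ toℕ b) (toℕ b <ᵇ toℕ c) (transitiveTriple G a b c) (independentTriple G a b c))

    ∑e : ∑ (λ a → ∑ λ b → ∑ λ c → e a b c) ≤ + 3 * (N * N)
    ∑e = begin
      ∑ (λ a → ∑ λ b → ∑ λ c → e a b c)
        ≡⟨ sum-cong-≗ (λ a → trans (sum-cong-≗ λ b → trans (∑-distrib-+ (λ c → isNon (κ a b) + isNon (κ b c)) (λ c → isNon (κ a c)))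
             (cong (λ s → s + ν a) (trans (∑-distrib-+ {n} (λ _ → isNon (κ a b)) (λ c → isNon (κ b c))) (cong (λ s → s + ν b) (∑-const n (isNon (κ a b)))))))
             (trans (∑-distrib-+ (λ b → N * isNon (κ a b) + ν b) (λ _ → ν a))
               (cong₂ _+_ (trans (∑-distrib-+ (λ b → N * isNon (κ a b)) ν) (cong (λ s → s + ∑ ν) (∑-*ˡ N (λ b → isNon (κ a b))))) (∑-const n (ν a))))) ⟩
      ∑ (λ a → N * ν a + ∑ ν + N * ν a)
        ≤⟨ ∑-mono {n} {λ a → N * ν a + ∑ ν + N * ν a} (λ a → +-mono-≤ (+-mono-≤ (*-monoˡ-≤-nonNeg N (∑-isNon n (toℕ a))) ∑ν≤N) (*-monoˡ-≤-nonNeg N (∑-isNon n (toℕ a)))) ⟩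
      ∑ {n} (λ _ → N * + 1 + N + N * + 1)
        ≡⟨ trans (∑-const n (N * + 1 + N + N * + 1)) (lemma N) ⟩
      + 3 * (N * N) ∎
      where
      open ≤-Reasoning
      ν : Fin n → ℤ
      ν a = ∑ λ c → isNon (κ a c)
      ∑ν≤N : ∑ ν ≤ N
      ∑ν≤N = ≤-trans (∑-mono {f = ν} (λ a → ∑-isNon n (toℕ a))) (≤-reflexive (trans (∑-const n (+ 1)) (*-identityʳ N)))
      lemma : ∀ N → N * (N * + 1 + N + N * + 1) ≡ + 3 * (N * N)
      lemma = solve-∀

    opaque
      unfolding orderings

      ti≤sym : ∀ a b c (d : Fin n) → ti (rel G a b) (rel G b c) (rel G a c) ≤
               sym₃ (sym₂ (λ a b c _ → g a b c)) a b c d + e a b c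
      ti≤sym a b c d = transport (κ a b) (κ b c) (κ a c) (rel G a b) (rel G b c) (rel G a c)
        (κ b a) (κ c b) (κ c a) (rel G b a) (rel G c b) (rel G c a)
        (κ-inv a b) (κ-inv b c) (κ-inv a c) (rel-inv G a b) (rel-inv G b c) (rel-inv G a c)
        where
        κ-inv : ∀ a b → κ b a ≡ inv (κ a b)
        κ-inv a b = compare-inv (toℕ a) (toℕ b)
        transport : ∀ r s q r′ s′ q′ rᵒ sᵒ qᵒ r′ᵒ s′ᵒ q′ᵒ →
          rᵒ ≡ inv r → sᵒ ≡ inv s → qᵒ ≡ inv q → r′ᵒ ≡ inv r′ → s′ᵒ ≡ inv s′ → q′ᵒ ≡ inv q′ →
          ti r′ s′ q′ ≤ (ordered r s * ti r′ s′ q′ + ordered rᵒ q * ti r′ᵒ q′ s′)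
            + (ordered q sᵒ * ti q′ s′ᵒ r′ + ordered qᵒ r * ti q′ᵒ r′ s′ᵒ)
            + (ordered s qᵒ * ti s′ q′ᵒ r′ᵒ + ordered sᵒ rᵒ * ti s′ᵒ r′ᵒ q′ᵒ) + (isNon r + isNon s + isNon q)
        transport r s q r′ s′ q′ _ _ _ _ _ _ refl refl refl refl refl refl = ti≤orderings r s q r′ s′ q′

    TI≤ : TI ≤ + 6 * (+ cT + + cI) + + 3 * (N * N)
    -- A dummy fourth vertex makes `∑₄-sym₂` and `∑₄-sym₃` applicable to triples; the factor N that
    -- it brings is cancelled.
    TI≤ = *-cancelˡ-≤-pos _ _ N (begin
      N * TI ≡⟨ ∑₄-const (λ a b c → ti (rel G a b) (rel G b c) (rel G a c)) ⟨
      ∑₄ (λ a b c _ → ti (rel G a b) (rel G b c) (rel G a c)) ≤⟨ ∑₄-mono ti≤sym ⟩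
      ∑₄ (λ a b c d → sym₃ (sym₂ g′) a b c d + e a b c) ≡⟨ ∑₄-+ (sym₃ (sym₂ g′)) (λ a b c _ → e a b c) ⟩
      ∑₄ (sym₃ (sym₂ g′)) + ∑₄ (λ a b c _ → e a b c)
        ≡⟨ cong₂ _+_ (trans (∑₄-sym₃ (sym₂ g′)) (cong (λ s → + 3 * s) (∑₄-sym₂ g′))) (∑₄-const e) ⟩
      + 3 * (+ 2 * ∑₄ g′) + N * ∑ (λ a → ∑ λ b → ∑ λ c → e a b c)
        ≤⟨ +-mono-≤ (≤-reflexive (cong (λ s → + 3 * (+ 2 * s)) (trans (∑₄-const g) (cong (λ s → N * s) ∑g)))) (*-monoˡ-≤-nonNeg N ∑e) ⟩
      + 3 * (+ 2 * (N * (+ cT + + cI))) + N * (+ 3 * (N * N)) ≡⟨ lemma N (+ cT + + cI) ⟩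
      N * (+ 6 * (+ cT + + cI) + + 3 * (N * N)) ∎)
      where
      open ≤-Reasoning
      g′ : Fin n → Fin n → Fin n → Fin n → ℤ
      g′ a b c _ = g a b c
      ∑₄-const : ∀ (f : Fin n → Fin n → Fin n → ℤ) → ∑₄ (λ a b c _ → f a b c) ≡ N * ∑ (λ a → ∑ λ b → ∑ λ c → f a b c)
      ∑₄-const f = trans (sum-cong-≗ λ a → trans (sum-cong-≗ λ b → trans (sum-cong-≗ λ c → ∑-const n (f a b c)) (∑-*ˡ N (f a b)))
        (∑-*ˡ N (λ b → ∑ (f a b)))) (∑-*ˡ N (λ a → ∑ λ b → ∑ (f a b)))
      lemma : ∀ N s → + 3 * (+ 2 * (N * s)) + N * (+ 3 * (N * N)) ≡ N * (+ 6 * s + + 3 * (N * N))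
      lemma = solve-∀

  -- The edit sets and their sizes.

  delete add : Bool → Bool → Bool
  delete a b = a ∧ not b
  add    a b = b ∧ not a

  opaque
    pairEdits : (o c d r : Rel) → ℤ
    pairEdits o c d r =
        𝟙ℤ (isFwd o ∧ (delete (isFwd r) (succ? c d) ∨ delete (isFwd (inv r)) (succ? d c)))
      + 𝟙ℤ (isFwd o ∧ (add (isFwd r) (succ? c d) ∨ add (isFwd (inv r)) (succ? d c)))

    -- A reversed edge needs a deletion and an addition and is wrong in both directions; any other
    -- faulty pair needs one edit and is wrong in one. The index order `o` lets at most one of the
    -- two orders of a pair count.
    pairEdits≤wrong : ∀ o c d r → pairEdits o c d r + pairEdits (inv o) d c (inv r) ≤ wrong c d r + wrong d c (inv r)
    pairEdits≤wrong = from-yes (∀Rel? λ o → ∀Rel? λ c → ∀Rel? λ d → ∀Rel? λ r →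
      pairEdits o c d r + pairEdits (inv o) d c (inv r) ≤? wrong c d r + wrong d c (inv r))

  editing : ∀ r c d →
    ((isFwd r ∧ not (delete (isFwd r) (succ? c d) ∨ delete (isFwd (inv r)) (succ? d c))) ∨ add (isFwd r) (succ? c d)) ≡ succ? c d
  editing = from-yes (∀Rel? λ r → ∀Rel? λ c → ∀Rel? λ d →
    ((isFwd r ∧ not (delete (isFwd r) (succ? c d) ∨ delete (isFwd (inv r)) (succ? d c))) ∨ add (isFwd r) (succ? c d))
      Bool.≟ succ? c d)

  module Editing {n : ℕ} .{{_ : ℕ.NonZero n}} (G : OrientedGraph n) (u : Fin n) where
    open Balancing (rel G) (rel-inv G) u public

    R A : Fin n → Fin n → Bool
    R x y = delete (isFwd (rel G x y)) (succ? (target x) (target y))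
    A x y = add (isFwd (rel G x y)) (succ? (target x) (target y))

    Badj-target : ∀ x y → succ? (target x) (target y) ≡ Badj (σ ⟨$⟩ʳ x) (σ ⟨$⟩ʳ y)
    Badj-target x y = trans (sym (succ?-index (target x) (target y)))
      (sym (cong₂ (λ p q → q ℕ.≡ᵇ next3 p) (part-select (σ ⟨$⟩ʳ x)) (part-select (σ ⟨$⟩ʳ y))))

    edited≡Badj : ∀ x y → edited G R A x y ≡ Badj (σ ⟨$⟩ʳ x) (σ ⟨$⟩ʳ y)
    edited≡Badj x y = trans (trans
      (cong₂ (λ a ρ → (a ∧ not (R x y ∨ delete (isFwd ρ) (succ? (target y) (target x)))) ∨ A x y) (adj-rel G x y) (rel-inv G x y))
      (editing (rel G x y) (target x) (target y))) (Badj-target x y)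

    private
      κ : Fin n → Fin n → Rel
      κ x y = compare (toℕ x) (toℕ y)

      p : Fin n → Fin n → ℤ
      p x y = pairEdits (κ x y) (target x) (target y) (rel G x y)

    opaque
      unfolding pairEdits

      count≡∑p : + (countPairs (λ x y → R x y ∨ R y x) ℕ.+ countPairs (λ x y → A x y ∨ A y x)) ≡ ∑ λ x → ∑ (p x)
      count≡∑p = trans (cong₂ _+_ (countPairs-∑ (λ x y → R x y ∨ R y x)) (countPairs-∑ (λ x y → A x y ∨ A y x)))
        (trans (sym (∑∑-+ (λ x y → 𝟙ℤ ((toℕ x <ᵇ toℕ y) ∧ (R x y ∨ R y x))) (λ x y → 𝟙ℤ ((toℕ x <ᵇ toℕ y) ∧ (A x y ∨ A y x)))))
          (sum-cong-≗ λ x → sum-cong-≗ λ y →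
            cong₂ (λ o ρ → 𝟙ℤ (o ∧ (R x y ∨ delete (isFwd ρ) (succ? (target y) (target x))))
                         + 𝟙ℤ (o ∧ (A x y ∨ add (isFwd ρ) (succ? (target y) (target x)))))
              (<ᵇ-compare (toℕ x) (toℕ y)) (rel-inv G x y)))

    count≤edits : + (countPairs (λ x y → R x y ∨ R y x) ℕ.+ countPairs (λ x y → A x y ∨ A y x)) ≤ edits
    count≤edits = subst (_≤ edits) (sym count≡∑p) (*-cancelˡ-≤-pos _ _ (+ 2) (subst₂ _≤_ (doubled p) (doubled w)
      (∑-mono λ x → ∑-mono λ y → subst₂ (λ o ρ → p x y + pairEdits o (target y) (target x) ρ ≤ w x y + wrong (target y) (target x) ρ)
        (sym (compare-inv (toℕ x) (toℕ y))) (sym (rel-inv G x y)) (pairEdits≤wrong (κ x y) (target x) (target y) (rel G x y)))))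
      where
      w : Fin n → Fin n → ℤ
      w x y = wrong (target x) (target y) (rel G x y)

  -- Binomial coefficients and rational inequalities.

  6*C3 : ∀ m → 6 ℕ.* ((2 ℕ.+ m) C 3) ≡ (2 ℕ.+ m) ℕ.* (1 ℕ.+ m) ℕ.* m
  6*C3 ℕ.zero    = refl
  6*C3 (ℕ.suc m) = begin
    6 ℕ.* ((3 ℕ.+ m) C 3)                               ≡⟨ cong (6 ℕ.*_) (sym (nCk+nC[k+1]≡[n+1]C[k+1] (2 ℕ.+ m) 2)) ⟩
    6 ℕ.* ((2 ℕ.+ m) C 2 ℕ.+ (2 ℕ.+ m) C 3)             ≡⟨ lemma₁ ((2 ℕ.+ m) C 2) ((2 ℕ.+ m) C 3) ⟩
    3 ℕ.* (2 ℕ.* ((2 ℕ.+ m) C 2)) ℕ.+ 6 ℕ.* ((2 ℕ.+ m) C 3) ≡⟨ cong₂ (λ a b → 3 ℕ.* a ℕ.+ b) (2*C2 (ℕ.suc m)) (6*C3 m) ⟩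
    3 ℕ.* ((2 ℕ.+ m) ℕ.* (1 ℕ.+ m)) ℕ.+ (2 ℕ.+ m) ℕ.* (1 ℕ.+ m) ℕ.* m ≡⟨ lemma₂ m ⟩
    (3 ℕ.+ m) ℕ.* (2 ℕ.+ m) ℕ.* (1 ℕ.+ m)               ∎
    where
    open ≡-Reasoning
    lemma₁ : ∀ a b → 6 ℕ.* (a ℕ.+ b) ≡ 3 ℕ.* (2 ℕ.* a) ℕ.+ 6 ℕ.* b
    lemma₁ = ℕ.solve-∀
    lemma₂ : ∀ m → 3 ℕ.* ((2 ℕ.+ m) ℕ.* (1 ℕ.+ m)) ℕ.+ (2 ℕ.+ m) ℕ.* (1 ℕ.+ m) ℕ.* m ≡ (3 ℕ.+ m) ℕ.* (2 ℕ.+ m) ℕ.* (1 ℕ.+ m)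
    lemma₂ = ℕ.solve-∀
    lemma₃ : ∀ m a → 2 ℕ.* (1 ℕ.+ m ℕ.+ a) ≡ 2 ℕ.* (1 ℕ.+ m) ℕ.+ 2 ℕ.* a
    lemma₃ = ℕ.solve-∀
    lemma₄ : ∀ m → 2 ℕ.* (1 ℕ.+ m) ℕ.+ (1 ℕ.+ m) ℕ.* m ≡ (2 ℕ.+ m) ℕ.* (1 ℕ.+ m)
    lemma₄ = ℕ.solve-∀
    2*C2 : ∀ m → 2 ℕ.* ((1 ℕ.+ m) C 2) ≡ (1 ℕ.+ m) ℕ.* m
    2*C2 ℕ.zero    = refl
    2*C2 (ℕ.suc m) = trans (cong (2 ℕ.*_) (trans (sym (nCk+nC[k+1]≡[n+1]C[k+1] (1 ℕ.+ m) 1)) (cong (ℕ._+ (1 ℕ.+ m) C 2) (nC1≡n (1 ℕ.+ m)))))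
      (trans (lemma₃ m ((1 ℕ.+ m) C 2)) (trans (cong (2 ℕ.* (1 ℕ.+ m) ℕ.+_) (2*C2 m)) (lemma₄ m)))

  C3-nonZero : ∀ n → 3 ℕ.≤ n → ℕ.NonZero (n C 3)
  C3-nonZero (ℕ.suc (ℕ.suc (ℕ.suc m))) _ = ℕ.m*n≢0⇒n≢0 6 {{subst ℕ.NonZero (sym (6*C3 (ℕ.suc m))) _}}
  C3-nonZero (ℕ.suc ℕ.zero) (s≤s ())
  C3-nonZero (ℕ.suc (ℕ.suc ℕ.zero)) (s≤s (s≤s ()))

  6*C3≤n³ : ∀ n → 6 ℕ.* (n C 3) ℕ.≤ n ℕ.* (n ℕ.* n)
  6*C3≤n³ 0 = z≤n
  6*C3≤n³ 1 = z≤n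
  6*C3≤n³ (ℕ.suc (ℕ.suc m)) = begin
    6 ℕ.* ((2 ℕ.+ m) C 3)              ≡⟨ 6*C3 m ⟩
    (2 ℕ.+ m) ℕ.* (1 ℕ.+ m) ℕ.* m      ≡⟨ ℕ.*-assoc (2 ℕ.+ m) (1 ℕ.+ m) m ⟩
    (2 ℕ.+ m) ℕ.* ((1 ℕ.+ m) ℕ.* m)    ≤⟨ ℕ.*-monoʳ-≤ (2 ℕ.+ m) (ℕ.*-mono-≤ (ℕ.n≤1+n (1 ℕ.+ m)) (ℕ.m≤n+m m 2)) ⟩
    (2 ℕ.+ m) ℕ.* ((2 ℕ.+ m) ℕ.* (2 ℕ.+ m)) ∎
    where open ℕ.≤-Reasoning

  -- Unnormalised rationals keep the literal denominators M, 9 and K; cross-multiplying there leaves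
  -- one surplus factor M, which cancels.
  clear-denominators : ∀ a b M K .{{_ : ℕ.NonZero M}} .{{_ : ℕ.NonZero K}} →
    ratio a M ℚ.+ ratio b M ℚ.≤ oneNinth ℚ.+ + 1 ℚ./ K →
    + 9 * (+ K * (+ a + + b)) ≤ (+ K + + 9) * + M
  clear-denominators a b M@(ℕ.suc m) K@(ℕ.suc k) h = *-cancelˡ-≤-pos _ _ (+ M)
    (subst₂ _≤_ (lemma₁ (+ a) (+ b) (+ M) (+ K)) (lemma₂ (+ M) (+ K)) (ℚᵘ.drop-*≤* unnormalised))
    where
    sum-≃ : ∀ p q → ℚ.toℚᵘ (ℚ.fromℚᵘ p ℚ.+ ℚ.fromℚᵘ q) ℚᵘ.≃ p ℚᵘ.+ q
    sum-≃ p q = ℚᵘ.≃-trans (ℚ.toℚᵘ-homo-+ (ℚ.fromℚᵘ p) (ℚ.fromℚᵘ q)) (ℚᵘ.+-cong (ℚ.toℚᵘ-fromℚᵘ p) (ℚ.toℚᵘ-fromℚᵘ q))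
    unnormalised : mkℚᵘ (+ a) m ℚᵘ.+ mkℚᵘ (+ b) m ℚᵘ.≤ mkℚᵘ (+ 1) 8 ℚᵘ.+ mkℚᵘ (+ 1) k
    unnormalised = ℚᵘ.≤-respˡ-≃ (sum-≃ (mkℚᵘ (+ a) m) (mkℚᵘ (+ b) m))
      (ℚᵘ.≤-respʳ-≃ (sum-≃ (mkℚᵘ (+ 1) 8) (mkℚᵘ (+ 1) k)) (ℚ.toℚᵘ-mono-≤ h))
    lemma₁ : ∀ a b M K → (a * M + b * M) * (+ 9 * K) ≡ M * (+ 9 * (K * (a + b)))
    lemma₁ = solve-∀
    lemma₂ : ∀ M K → (+ 1 * K + + 1 * + 9) * (M * M) ≡ M * ((K + + 9) * M)
    lemma₂ = solve-∀

  -- The numerator of a positive ε is at least 1, so ε is at least the reciprocal of its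
  -- denominator.
  ≤-ε* : ∀ ε → 0ℚ ℚ.< ε → ∀ a b → ℚ.↧ₙ ε ℕ.* a ℕ.≤ b → + a ℚ./ 1 ℚ.≤ ε ℚ.* (+ b ℚ./ 1)
  ≤-ε* (mkℚ (+ 0) d _) 0<ε with +<+ () ← ℚ.drop-*<* 0<ε
  ≤-ε* (mkℚ -[1+ _ ] d _) 0<ε with () ← ℚ.drop-*<* 0<ε
  ≤-ε* ε@(mkℚ +[1+ p ] d _) 0<ε a b da≤b = ℚ.toℚᵘ-cancel-≤
    (ℚᵘ.≤-respˡ-≃ (ℚᵘ.≃-sym (ℚ.toℚᵘ-fromℚᵘ (mkℚᵘ (+ a) 0)))
      (ℚᵘ.≤-respʳ-≃ (ℚᵘ.≃-sym (ℚᵘ.≃-trans (ℚ.toℚᵘ-homo-* ε (+ b ℚ./ 1))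
                        (ℚᵘ.*-cong (ℚᵘ.≃-refl {ℚ.toℚᵘ ε}) (ℚ.toℚᵘ-fromℚᵘ (mkℚᵘ (+ b) 0)))))
        (*≤* (subst₂ _≤_ (pos-* a (ℕ.suc d ℕ.* 1)) (sym (trans (*-identityʳ (+[1+ p ] * + b)) (sym (pos-* (ℕ.suc p) b))))
          (+≤+ (begin
            a ℕ.* (ℕ.suc d ℕ.* 1) ≡⟨ trans (cong (a ℕ.*_) (ℕ.*-identityʳ (ℕ.suc d))) (ℕ.*-comm a (ℕ.suc d)) ⟩
            ℕ.suc d ℕ.* a         ≤⟨ da≤b ⟩
            b                     ≤⟨ ℕ.m≤n*m b (ℕ.suc p) ⟩
            ℕ.suc p ℕ.* b         ∎))))))
    where open ℕ.≤-Reasoning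

  -- Choice of the constants and conclusion.

  module Threshold (ε : ℚ) (0<ε : 0ℚ ℚ.< ε) where

    private
      -- 1/k bounds the relative error of the degrees, and K = 25 k² is what ∑S-bound asks for.
      q k K : ℕ
      q = ℚ.↧ₙ ε
      k = 24 ℕ.* q
      K = 25 ℕ.* (k ℕ.* k)

      instance
        k≢0 : ℕ.NonZero k
        k≢0 = ℕ.m*n≢0 24 q
        k²≢0 : ℕ.NonZero (k ℕ.* k)
        k²≢0 = ℕ.m*n≢0 k k
        K≢0 : ℕ.NonZero K
        K≢0 = ℕ.m*n≢0 25 (k ℕ.* k)

    -- Triples with repetitions cost 9 · K · 3 N² in `TI-small`; n ≥ 27 K makes this at most N³, the
    -- step from K + 9 to K + 10.
    n₀ : ℕ
    n₀ = 27 ℕ.* K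

    δ : ℚ
    δ = + 1 ℚ./ K

    0<δ : 0ℚ ℚ.< δ
    0<δ = ℚ.positive⁻¹ δ {{ℚ.normalize-pos 1 K}}

    close : ∀ n (G : OrientedGraph n) → n ℕ.≥ n₀ →
      Defs.t G ℚ.+ Defs.i G ℚ.≤ oneNinth ℚ.+ δ → CloseToB ε G
    close n G n≥27K h = R , A , ≤-ε* ε 0<ε _ (n ℕ.* n) q*count≤n² , σ , edited≡Badj
      where
      n≥27 : 27 ℕ.≤ n
      n≥27 = ℕ.≤-trans (ℕ.m≤m*n 27 K) n≥27K
      instance
        n≢0 : ℕ.NonZero n
        n≢0 = ℕ.>-nonZero (ℕ.≤-trans (s≤s z≤n) n≥27)
        C≢0 : ℕ.NonZero (n C 3)
        C≢0 = C3-nonZero n (ℕ.≤-trans (s≤s (s≤s (s≤s z≤n))) n≥27)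
      open Counting G
      open Density (rel G) (rel-inv G)
      open Rounding (rel G) (rel-inv G)

      N : ℤ
      N = + n

      +K : + K ≡ + 25 * (+ k * + k)
      +K = trans (pos-* 25 (k ℕ.* k)) (cong (λ s → + 25 * s) (pos-* k k))

      27K≤N : + 27 * + K ≤ N
      27K≤N = subst (_≤ N) (pos-* 27 K) (+≤+ n≥27K)

      6C≤N³ : + 6 * + (n C 3) ≤ N * (N * N)
      6C≤N³ = subst₂ _≤_ (pos-* 6 (n C 3)) (trans (pos-* n (n ℕ.* n)) (cong (λ s → N * s) (pos-* n n))) (+≤+ (6*C3≤n³ n))

      TI-small : + 9 * (+ K * TI) ≤ (+ K + + 10) * (N * (N * N))
      TI-small = ≤-by
        ( 0≤i*j (0≤*ˡ 9 (+≤+ {0} {K} z≤n)) (i≤j⇒0≤j-i TI≤)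
        ⊕ 0≤*ˡ 6 (i≤j⇒0≤j-i (clear-denominators cT cI (n C 3) K h))
        ⊕ 0≤i*j {+ K + + 9} (+≤+ z≤n) (i≤j⇒0≤j-i 6C≤N³)
        ⊕ 0≤i*j (0≤i*i N) (i≤j⇒0≤j-i 27K≤N))
        (lemma (+ K) N TI (+ cT) (+ cI) (+ (n C 3)))
        where
        lemma : ∀ K N j x y c →
          + 9 * K * (+ 6 * (x + y) + + 3 * (N * N) - j)
          + (+ 6 * ((K + + 9) * c - + 9 * (K * (x + y)))
          + ((K + + 9) * (N * (N * N) - + 6 * c) + N * N * (N - + 27 * K)))
          ≡ (K + + 10) * (N * (N * N)) - + 9 * (K * j)
        lemma = solve-∀

      ∑S-small : + k * + k * ∑ S ≤ N * (N * N)
      ∑S-small = ∑S-bound (+ k) (subst (λ K → + 9 * (K * TI) ≤ (K + + 10) * (N * (N * N))) +K TI-small)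

      typical : Σ (Fin n) λ u → + k * + k * S u ≤ N * N
      typical = ∃-≤-average (λ u → + k * + k * S u) (N * N)
        (subst (_≤ N * (N * N)) (sym (∑-*ˡ (+ k * + k) S)) ∑S-small)

      open Editing G (proj₁ typical)

      k≤n : k ℕ.≤ n
      k≤n = ℕ.≤-trans (ℕ.m≤m*n k k) (ℕ.≤-trans (ℕ.m≤n*m (k ℕ.* k) 25) (ℕ.≤-trans (ℕ.m≤n*m K 27) n≥27K))

      count : ℕ
      count = countPairs (λ x y → R x y ∨ R y x) ℕ.+ countPairs (λ x y → A x y ∨ A y x)

      q*count≤n² : q ℕ.* count ℕ.≤ n ℕ.* n
      q*count≤n² = drop‿+≤+ (subst₂ _≤_ (sym (pos-* q count)) (sym (pos-* n n))
        (*-cancelˡ-≤-pos _ _ (+ 24) (≤-trans (≤-reflexive 24*q) (≤-trans (*-monoˡ-≤-nonNeg (+ k) count≤edits)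
          (edits-bound (+ k) (+≤+ (ℕ.>-nonZero⁻¹ k)) (+≤+ k≤n) ∑S-small (proj₂ typical))))))
        where
        24*q : + 24 * (+ q * + count) ≡ + k * + count
        24*q = trans (sym (*-assoc (+ 24) (+ q) (+ count))) (cong (λ s → s * + count) (sym (pos-* 24 q)))

open import Defs
open import Data.Nat using (ℕ; _≥_)
open import Data.Product using (Σ; _×_; _,_)
open import Data.Rational using (ℚ; _<_; _≤_; _+_; 0ℚ)

theorem1p4 : (ε : ℚ) → 0ℚ < ε →
    Σ ℕ λ n₀ → Σ ℚ λ δ → (0ℚ < δ) ×
    (∀ (n : ℕ) (G : OrientedGraph n) → n ≥ n₀ →
    t G + i G ≤ oneNinth + δ → CloseToB ε G)
theorem1p4 ε 0<ε = n₀ , δ , 0<δ , close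
  where open Stability.Threshold ε 0<ε
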